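{- Let $n\ge 21$, $2\le s\le 2^{n-1}$ and $0\le i\le \binom{n}{2}$. Suppose that $\mathcal{A}\subset \mathcal{P}([n])$ is a family of size $\sum_{k=3}^n \binom{n}{k}+i$ of the form $[n]^{(\ge 3)}\cup \mathcal{B}$ with $\mathcal{B}\subset [n]^{(2)}$, and that among all families of this form and this size, $\mathcal{A}$ contains the maximal number of intersecting subfamilies of size $s$. Then $\mathcal{B}$ is a family of size $i$ contained in $[n]^{(2)}$ which contains the maximal number of intersecting (unordered) pairs $\{B,B'\}$, $B\neq B'$, $B\cap B'\ne\emptyset$, among all families of size $i$ contained in $[n]^{(2)}$.
   Context: $[n]=\{1,\dots,n\}$, $\mathcal{P}([n])$ is its power set, $[n]^{(r)}$ is the set of $r$-element subsets of $[n]$ and $[n]^{(\ge r)}$ the set of subsets of size at least $r$. A family $\mathcal{F}$ of sets is intersecting if $F\cap F'\neq\emptyset$ for all $F,F'\in\mathcal{F}$. -}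

module Defs where

open import Data.Nat using (ℕ; zero; suc; _+_; _∸_)
open import Data.Nat.Combinatorics using (_C_)
open import Data.Product using (_×_)
open import Data.List using (List; []; _∷_; map; _++_; length; filter; upTo)
open import Data.Nat.ListAction using (sum)
open import Data.List.Relation.Unary.All using (All; all?)
open import Data.Fin.Subset using (Subset; _∩_; Nonempty; ∣_∣)
open import Data.Fin.Subset.Properties using (nonempty?)
open import Data.Nat.Properties using (_≟_)
open import Relation.Nullary.Decidable using (Dec; _×-dec_)

-- A family of subsets of [n] is represented as a duplicate-free list of
-- subsets (duplicate-freeness is imposed where families are quantified).
Family : ℕ → Set
Family n = List (Subset n)

-- All sub-lists of a list (2^length many); for a duplicate-free list these
-- are exactly the subfamilies, each listed once.
sublists : ∀ {a} {A : Set a} → List A → List (List A)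
sublists []       = [] ∷ []
sublists (x ∷ xs) = let r = sublists xs in r ++ map (x ∷_) r

Intersecting : ∀ {n} → Family n → Set
Intersecting 𝓕 = All (λ F → All (λ F' → Nonempty (F ∩ F')) 𝓕) 𝓕

intersecting? : ∀ {n} (𝓕 : Family n) → Dec (Intersecting 𝓕)
intersecting? 𝓕 = all? (λ F → all? (λ F' → nonempty? (F ∩ F')) 𝓕) 𝓕

numIntersecting : ∀ {n} → ℕ → Family n → ℕ
numIntersecting s 𝓐 =
  length (filter (λ 𝓕 → (length 𝓕 ≟ s) ×-dec intersecting? 𝓕) (sublists 𝓐))

intersectingPairs : ∀ {n} → Family n → ℕ
intersectingPairs []       = 0
intersectingPairs (B ∷ 𝓑) =
  length (filter (λ B' → nonempty? (B ∩ B')) 𝓑) + intersectingPairs 𝓑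

sumBinomFrom3 : ℕ → ℕ
sumBinomFrom3 n = sum (map (λ j → n C (3 + j)) (upTo (n ∸ 2)))

{-# OPTIONS --safe #-}
-- Sort the intersecting subfamilies of size s of [n]^(≥3) ∪ 𝓑 by their trace T,
-- the set of their two-element members: the total is the sum over T ⊆ 𝓑 of the
-- number g(T) of families with trace T, and g(T) is invariant under permutations
-- of [n]. For |𝓑| fixed, the traces with at most one member contribute the same
-- amount for every 𝓑, and each intersecting pair contributes the same γ > 0. So it
-- is enough that the traces with at least three members contribute less than γ in
-- total. Such a trace is a star or a triangle. An edge e is removed from it by
-- choosing S disjoint from the trace and replacing the members between e and e ∪ S
-- by complements; since S can be recovered, every family with trace e ∷ T yields
-- many families with trace T. This gives g(T) ≤ γ / 2^(n-5) for |T| = 3 and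
-- g(T) ≤ γ / 2^(2n-11) for |T| ≥ 4, and for n ≥ 21 there are few enough stars and
-- triangles.

module Submission where

open import Defs
open import Data.Nat using (ℕ; _≤_; _^_; _∸_; _+_)
open import Data.Nat.Combinatorics using (_C_)
open import Data.Product using (_×_)
open import Data.Sum using (_⊎_)
open import Data.List using (List; length)
open import Data.List.Relation.Unary.All using (All)
open import Data.List.Relation.Unary.Unique.Propositional using (Unique)
open import Data.List.Membership.Propositional using (_∈_)
open import Data.Fin.Subset using (Subset; ∣_∣)
open import Relation.Binary.PropositionalEquality using (_≡_)
open import Function.Bundles using (_⇔_)
open import Data.Nat using (zero; suc; >-nonZero; _*_; _<_; z≤n; s≤s; _≟_; _≤?_)
open import Data.Nat.Combinatorics using (nC1≡n; nCk+nC[k+1]≡[n+1]C[k+1])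
open import Data.Nat.ListAction using (sum)
open import Data.Nat.ListAction.Properties using (sum-++)
open import Data.Nat.Properties as ℕP
  using (+-assoc; +-identityʳ; +-mono-≤; +-monoʳ-≤; *-zeroʳ; *-identityʳ; *-distribˡ-+; *-identityˡ; ≤-refl;
    ≤-trans; ≤-reflexive; m≤m+n; m≤n+m; m≤n⇒m≤o+n; ≤-antisym)
open import Data.Nat.Tactic.RingSolver using (solve-∀)
open import Data.Bool using (Bool; true; false; if_then_else_; _∧_)
import Data.Bool.Properties as Bool
open import Data.Fin using (Fin; zero; suc)
open import Data.Fin.Subset as Sub using (_∩_; _∪_; ∁; ⊥; Nonempty; ⁅_⁆) renaming (_⊆_ to _⊑_)
open import Data.Fin.Subset.Properties as SubP
  using (p∩q⊆p; p∩q⊆q; x∈p∩q⁺; x∈p∩q⁻; x∈p∪q⁺; x∈p∪q⁻; p⊆q⇒∣p∣≤∣q∣; x∈⁅x⁆; ∣⁅x⁆∣≡1; x∈⁅y⁆⇒x≡y; ⊆-antisym; ∉⊥;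
    x∈∁p⇒x∉p; x∉p⇒x∈∁p; _⊆?_; nonempty?; ∩-comm; anySubset?; ⊥⊆; p⊂q⇒∣p∣<∣q∣; p⊆q⇒∁p⊇∁q)
open import Data.Vec as Vec using ([]; _∷_; lookup; removeAt; insertAt)
import Data.Vec.Properties as VecP
open import Data.List using ([]; _∷_; _++_; [_]; map; filter; cartesianProduct; take; allFin; upTo)
open import Data.List.Properties
  using (length-++; map-++; map-∘; map-cong; length-map; map-id; length-take; length-tabulate; take++drop≡id;
    filter-++; filter-none; filter-≐; upTo-∷ʳ)
open import Data.List.Membership.Propositional using (find)
open import Data.List.Membership.Propositional.Properties
  using (∈-∃++; ∈-++⁺ˡ; ∈-++⁺ʳ; ∈-++⁻; ∈-map⁺; ∈-map⁻; ∈-filter⁺; ∈-filter⁻; ∈-allFin; ∈-cartesianProduct⁺;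
    ∈-cartesianProduct⁻)
open import Data.List.Membership.Propositional.Properties.WithK using (unique∧set⇒bag)
import Data.List.Membership.DecPropositional as DecMembership
open import Data.List.Relation.Unary.Any using (here; there)
open import Data.List.Relation.Unary.All as All using ([]; _∷_; all?)
open import Data.List.Relation.Unary.All.Properties as AllP using (All¬⇒¬Any; ¬Any⇒All¬; ¬All⇒Any¬)
open import Data.List.Relation.Unary.AllPairs using ([]; _∷_)
import Data.List.Relation.Unary.Unique.Propositional.Properties as Uniq
open import Data.List.Relation.Binary.BagAndSetEquality using (∼bag⇒↭)
open import Data.List.Relation.Binary.Permutation.Propositional as Perm using (_↭_; ↭-sym; ↭-refl)
open import Data.List.Relation.Binary.Permutation.Propositional.Properties using (↭-length; ∈-resp-↭)
open import Data.List.Relation.Binary.Sublist.Propositional using (_⊆_; []; _∷_; _∷ʳ_)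
open import Data.List.Relation.Binary.Sublist.Propositional.Properties using (All-resp-⊆; Any-resp-⊆)
open import Data.Product using (_,_; proj₁; proj₂; ∃-syntax)
open import Data.Sum as Sum using (inj₁; inj₂)
open import Data.Unit using (tt)
open import Function using (_∘_; mk⇔)
open import Function.Bundles using (Equivalence)
open import Level using (Level)
open import Relation.Binary.Definitions using (DecidableEquality)
open import Relation.Binary.PropositionalEquality hiding ([_])
open import Relation.Nullary using (Dec; yes; no; does; ¬_; contradiction)
open import Relation.Nullary.Decidable using (dec-true; dec-false; _×-dec_)
open import Relation.Unary using (Pred; Decidable)

-- The obstacle lies with the members that contain exactly one end of `e` and otherwise lie in `S`:
-- they are disjoint from the complement of `e ∪ S`, and that complement is always present after the
-- replacement. For a triangle there are none, because a member with one end of `e` must contain the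
-- third vertex, which `S` avoids. For a star, a member missing the centre contains all other
-- leaves, but a member containing the centre may well lie in the centre together with `S`. In that
-- case the complement of `S` among the points off the star takes the place of `S`, if necessary
-- after an involution of the family that keeps its trace. One point is withheld from `S`, so that
-- the image tells `S` from such a complement. Hence the exponents. A star of three edges occupies
-- four points and one more is withheld, which leaves n - 5; a star of four edges leaves n - 6, and
-- (n - 6) + (n - 5) = 2n - 11. For a triangle, n - 5 arises because complements must keep three
-- points. All bounds are in units of γ and uniform in s; the upper bound on s enters only through γ
-- > 0.

private variable
  a p : Level
  A : Set a
  P Q : Pred A p

-- Duplicate-free lists and their sublists

∈-here-or-there : ∀ {x y : A} (as {bs} : List A) → x ∈ as ++ [ y ] ++ bs → ¬ y ≡ x → x ∈ as ++ bs
∈-here-or-there as x∈ y≢x with ∈-++⁻ as x∈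
... | inj₁ x∈as           = ∈-++⁺ˡ x∈as
... | inj₂ (here x≡y)     = contradiction (sym x≡y) y≢x
... | inj₂ (there x∈bs)   = ∈-++⁺ʳ as x∈bs

length-mono-∈ : ∀ {xs ys : List A} → Unique xs → (∀ {x} → x ∈ xs → x ∈ ys) → length xs ≤ length ys
length-mono-∈ {xs = []}     _            _  = z≤n
length-mono-∈ {xs = x ∷ xs} (x∉ ∷ uniq) sub with ∈-∃++ (sub (here refl))
... | as , bs , refl = ≤-trans
  (s≤s (length-mono-∈ {ys = as ++ bs} uniq
    (λ y∈ → ∈-here-or-there as (sub (there y∈)) (All.lookup x∉ y∈))))
  (≤-reflexive (trans (cong suc (length-++ as)) (trans (sym (ℕP.+-suc (length as) _)) (sym (length-++ as)))))

unique⇒↭ : ∀ {xs ys : List A} → Unique xs → Unique ys →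
  (∀ {x} → x ∈ xs → x ∈ ys) → (∀ {x} → x ∈ ys → x ∈ xs) → xs ↭ ys
unique⇒↭ ux uy f g = ∼bag⇒↭ (unique∧set⇒bag ux uy (mk⇔ f g))

∈-sublists⁻ : ∀ {T : List A} xs → T ∈ sublists xs → T ⊆ xs
∈-sublists⁻ []       (here refl) = []
∈-sublists⁻ (x ∷ xs) T∈ with ∈-++⁻ (sublists xs) T∈
... | inj₁ T∈xs = x ∷ʳ ∈-sublists⁻ xs T∈xs
... | inj₂ T∈x∷ with ∈-map⁻ (x ∷_) T∈x∷
...   | S , S∈xs , refl = refl ∷ ∈-sublists⁻ xs S∈xs

filter∈sublists : (P? : Decidable P) (xs : List A) → filter P? xs ∈ sublists xs
filter∈sublists P? []       = here refl
filter∈sublists P? (x ∷ xs) with does (P? x)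
... | true  = ∈-++⁺ʳ (sublists xs) (∈-map⁺ (x ∷_) (filter∈sublists P? xs))
... | false = ∈-++⁺ˡ (filter∈sublists P? xs)

unique-resp-⊆ : ∀ {T xs : List A} → T ⊆ xs → Unique xs → Unique T
unique-resp-⊆ []          []         = []
unique-resp-⊆ (y ∷ʳ sub)  (_ ∷ u)    = unique-resp-⊆ sub u
unique-resp-⊆ (refl ∷ sub) (x∉ ∷ u)  = All-resp-⊆ sub x∉ ∷ unique-resp-⊆ sub u

sublists-unique : ∀ {xs : List A} → Unique xs → Unique (sublists xs)
sublists-unique {xs = []}     []       = [] ∷ []
sublists-unique {xs = x ∷ xs} (x∉ ∷ u) =
  Uniq.++⁺ (sublists-unique u) (Uniq.map⁺ (λ { refl → refl }) (sublists-unique u)) disjoint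
  where
  disjoint : ∀ {T} → T ∈ sublists xs × T ∈ map (x ∷_) (sublists xs) → _
  disjoint (T∈ , T∈x∷) with ∈-map⁻ (x ∷_) T∈x∷
  ... | S , _ , refl = All¬⇒¬Any x∉ (Any-resp-⊆ (∈-sublists⁻ xs T∈) (here refl))

-- In a duplicate-free list a sublist is determined by its set of members. This is what lets a
-- family be recovered from its characteristic function as the very same list.
sublist≡filter : ∀ {T xs : List A} → Unique xs → T ⊆ xs → (P? : Decidable P) →
  (∀ {x} → x ∈ xs → P x → x ∈ T) → (∀ {x} → x ∈ T → P x) → filter P? xs ≡ T
sublist≡filter _        []         P? f g = refl
sublist≡filter (x∉ ∷ u) (x ∷ʳ sub) P? f g with P? x
... | yes Px = contradiction (Any-resp-⊆ sub (f (here refl) Px)) (All¬⇒¬Any x∉)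
... | no  _  = sublist≡filter u sub P? (λ x∈ → f (there x∈)) g
sublist≡filter {T = x ∷ T} {xs = x ∷ xs} (x∉ ∷ u) (refl ∷ sub) P? f g with P? x
... | no ¬Px = contradiction (g (here refl)) ¬Px
... | yes _  = cong (x ∷_) (sublist≡filter u sub P? f′ (λ x∈ → g (there x∈)))
  where
  f′ : ∀ {y} → y ∈ xs → _ → y ∈ T
  f′ y∈ Py with f (there y∈) Py
  ... | here refl = contradiction y∈ (All¬⇒¬Any x∉)
  ... | there y∈T = y∈T

-- Sums over sublists

sumSub : (List A → ℕ) → List A → ℕ
sumSub h []       = h []
sumSub h (x ∷ xs) = sumSub h xs + sumSub (h ∘ (x ∷_)) xs

indicator : Dec {a} A → ℕ
indicator d = if does d then 1 else 0

sumSub-sublists : (h : List A → ℕ) (xs : List A) → sumSub h xs ≡ sum (map h (sublists xs))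
sumSub-sublists h []       = sym (+-identityʳ _)
sumSub-sublists h (x ∷ xs) = begin
  sumSub h xs + sumSub (h ∘ (x ∷_)) xs
    ≡⟨ cong₂ _+_ (sumSub-sublists h xs) (sumSub-sublists (h ∘ (x ∷_)) xs) ⟩
  sum (map h (sublists xs)) + sum (map (h ∘ (x ∷_)) (sublists xs))
    ≡⟨ cong (λ l → sum (map h (sublists xs)) + sum l) (map-∘ (sublists xs)) ⟩
  sum (map h (sublists xs)) + sum (map h (map (x ∷_) (sublists xs)))
    ≡⟨ sum-++ (map h (sublists xs)) _ ⟨
  sum (map h (sublists xs) ++ map h (map (x ∷_) (sublists xs)))
    ≡⟨ cong sum (map-++ h (sublists xs) _) ⟨
  sum (map h (sublists (x ∷ xs))) ∎
  where open ≡-Reasoning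

length-filter≡sum : (P? : Decidable P) (xs : List A) → length (filter P? xs) ≡ sum (map (indicator ∘ P?) xs)
length-filter≡sum P? []       = refl
length-filter≡sum P? (x ∷ xs) with does (P? x)
... | true  = cong suc (length-filter≡sum P? xs)
... | false = length-filter≡sum P? xs

length-filter-sublists : (P? : Decidable P) (xs : List A) →
  length (filter P? (sublists xs)) ≡ sumSub (indicator ∘ P?) xs
length-filter-sublists P? xs = trans (length-filter≡sum P? (sublists xs)) (sym (sumSub-sublists _ xs))

sumSub-mono : ∀ {h k : List A → ℕ} (xs : List A) → (∀ {T} → T ⊆ xs → h T ≤ k T) → sumSub h xs ≤ sumSub k xs
sumSub-mono []       h≤k = h≤k []
sumSub-mono (x ∷ xs) h≤k =
  +-mono-≤ (sumSub-mono xs (λ sub → h≤k (x ∷ʳ sub))) (sumSub-mono xs (λ sub → h≤k (refl ∷ sub)))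

sumSub-cong : ∀ {h k : List A → ℕ} (xs : List A) → (∀ T → h T ≡ k T) → sumSub h xs ≡ sumSub k xs
sumSub-cong []       h≡k = h≡k []
sumSub-cong (x ∷ xs) h≡k = cong₂ _+_ (sumSub-cong xs h≡k) (sumSub-cong xs (λ T → h≡k (x ∷ T)))

+-interchange : ∀ m n o q → (m + n) + (o + q) ≡ (m + o) + (n + q)
+-interchange = solve-∀

sumSub-+ : ∀ (h k : List A → ℕ) xs → sumSub (λ T → h T + k T) xs ≡ sumSub h xs + sumSub k xs
sumSub-+ h k []       = refl
sumSub-+ h k (x ∷ xs) = trans
  (cong₂ _+_ (sumSub-+ h k xs) (sumSub-+ (h ∘ (x ∷_)) (k ∘ (x ∷_)) xs))
  (+-interchange (sumSub h xs) _ _ _)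

sumSub-* : ∀ c (h : List A → ℕ) xs → sumSub (λ T → c * h T) xs ≡ c * sumSub h xs
sumSub-* c h []       = refl
sumSub-* c h (x ∷ xs) = trans
  (cong₂ _+_ (sumSub-* c h xs) (sumSub-* c (h ∘ (x ∷_)) xs))
  (sym (*-distribˡ-+ c (sumSub h xs) _))

sumSub-++ : ∀ (h : List A → ℕ) xs ys →
  sumSub h (xs ++ ys) ≡ sumSub (λ T → sumSub (λ G → h (T ++ G)) ys) xs
sumSub-++ h []       ys = refl
sumSub-++ h (x ∷ xs) ys = cong₂ _+_ (sumSub-++ h xs ys) (sumSub-++ (h ∘ (x ∷_)) xs ys)

-- Permuting the list also permutes the entries inside each sublist, hence the invariance asked of
-- `h`.
sumSub-↭ : ∀ (h : List A → ℕ) → (∀ {S T} → S ↭ T → h S ≡ h T) → ∀ {xs ys} → xs ↭ ys → sumSub h xs ≡ sumSub h ys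
sumSub-↭ h inv Perm.refl         = refl
sumSub-↭ h inv (Perm.prep x xs↭ys) =
  cong₂ _+_ (sumSub-↭ h inv xs↭ys) (sumSub-↭ (h ∘ (x ∷_)) (λ S↭T → inv (Perm.prep x S↭T)) xs↭ys)
sumSub-↭ h inv (Perm.swap {xs = xs} {ys = ys} x y xs↭ys) = begin
  (sumSub h xs + sumSub (h ∘ (y ∷_)) xs) + (sumSub (h ∘ (x ∷_)) xs + sumSub (λ T → h (x ∷ y ∷ T)) xs)
    ≡⟨ cong₂ _+_
         (cong₂ _+_ (sumSub-↭ h inv xs↭ys) (sumSub-↭ _ (λ S↭T → inv (Perm.prep y S↭T)) xs↭ys))
         (cong₂ _+_ (sumSub-↭ _ (λ S↭T → inv (Perm.prep x S↭T)) xs↭ys)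
           (trans (sumSub-cong xs (λ T → inv (Perm.swap x y Perm.refl)))
             (sumSub-↭ _ (λ S↭T → inv (Perm.prep y (Perm.prep x S↭T))) xs↭ys))) ⟩
  (sumSub h ys + sumSub (h ∘ (y ∷_)) ys) + (sumSub (h ∘ (x ∷_)) ys + sumSub (λ T → h (y ∷ x ∷ T)) ys)
    ≡⟨ +-interchange (sumSub h ys) _ _ _ ⟩
  (sumSub h ys + sumSub (h ∘ (x ∷_)) ys) + (sumSub (h ∘ (y ∷_)) ys + sumSub (λ T → h (y ∷ x ∷ T)) ys) ∎
  where open ≡-Reasoning
sumSub-↭ h inv (Perm.trans p q) = trans (sumSub-↭ h inv p) (sumSub-↭ h inv q)

sumSub-filter : (P? : Decidable P) (h : List A → ℕ) (xs : List A) →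
  sumSub (λ T → indicator (all? P? T) * h T) xs ≡ sumSub h (filter P? xs)
sumSub-filter P? h []       = *-identityˡ (h [])
sumSub-filter P? h (x ∷ xs) with does (P? x)
... | true  = cong₂ _+_ (sumSub-filter P? h xs) (sumSub-filter P? (h ∘ (x ∷_)) xs)
... | false = trans (cong₂ _+_ (sumSub-filter P? h xs) (sumSub-* 0 (h ∘ (x ∷_)) xs)) (+-identityʳ _)

sum-map-sumSub : ∀ {b} {B : Set b} (k : B → List A → ℕ) (J : List B) xs →
  sum (map (λ j → sumSub (k j) xs) J) ≡ sumSub (λ T → sum (map (λ j → k j T) J)) xs
sum-map-sumSub k []      xs = sym (sumSub-* 0 (λ _ → 0) xs)
sum-map-sumSub k (j ∷ J) xs = trans (cong (sumSub (k j) xs +_) (sum-map-sumSub k J xs)) (sym (sumSub-+ (k j) _ xs))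

∈⇒≤sum : ∀ {b} {B : Set b} (k : B → ℕ) {j J} → j ∈ J → k j ≤ sum (map k J)
∈⇒≤sum k (here refl) = m≤m+n _ _
∈⇒≤sum k (there j∈)  = m≤n⇒m≤o+n _ (∈⇒≤sum k j∈)

module _ (_≟A_ : DecidableEquality A) where
  open DecMembership _≟A_ using (_∈?_)

  -- This is the union bound: a sublist lying in several members of `J` is counted several times on
  -- the right, and one on which `h` vanishes need not be covered.
  sumSub-cover : ∀ (h : List A → ℕ) (J : List (List A)) xs →
    (∀ {T} → T ⊆ xs → h T ≡ 0 ⊎ ∃[ L ] L ∈ J × All (_∈ L) T) →
    sumSub h xs ≤ sum (map (λ L → sumSub h (filter (_∈? L) xs)) J)
  sumSub-cover h J xs cover = begin
    sumSub h xs
      ≤⟨ sumSub-mono xs bound ⟩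
    sumSub (λ T → sum (map (λ L → indicator (all? (_∈? L) T) * h T) J)) xs
      ≡⟨ sum-map-sumSub (λ L T → indicator (all? (_∈? L) T) * h T) J xs ⟨
    sum (map (λ L → sumSub (λ T → indicator (all? (_∈? L) T) * h T) xs) J)
      ≡⟨ cong sum (map-cong (λ L → sumSub-filter (_∈? L) h xs) J) ⟩
    sum (map (λ L → sumSub h (filter (_∈? L) xs)) J) ∎
    where
    open ℕP.≤-Reasoning
    bound : ∀ {T} → T ⊆ xs → h T ≤ sum (map (λ L → indicator (all? (_∈? L) T) * h T) J)
    bound {T} sub with cover sub
    ... | inj₁ h≡0 = ≤-trans (≤-reflexive h≡0) z≤n
    ... | inj₂ (L , L∈J , T⊆L) = ≤-trans
      (≤-reflexive (trans (sym (*-identityˡ (h T)))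
        (cong (λ b → (if b then 1 else 0) * h T) (sym (dec-true (all? (_∈? L) T) T⊆L)))))
      (∈⇒≤sum (λ L → indicator (all? (_∈? L) T) * h T) L∈J)

from₁ from₂ from₃ : (List A → ℕ) → List A → ℕ
from₁ h []            = 0
from₁ h (x ∷ T)       = h (x ∷ T)
from₂ h (x ∷ y ∷ T)   = h (x ∷ y ∷ T)
from₂ h _             = 0
from₃ h (x ∷ y ∷ z ∷ T) = h (x ∷ y ∷ z ∷ T)
from₃ h _             = 0

sumPairs : (A → A → ℕ) → List A → ℕ
sumPairs k []       = 0
sumPairs k (x ∷ xs) = sum (map (k x) xs) + sumPairs k xs

sumSub-from₁ : (h : List A → ℕ) (xs : List A) → sumSub h xs ≡ h [] + sumSub (from₁ h) xs
sumSub-from₁ h []       = sym (+-identityʳ _)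
sumSub-from₁ h (x ∷ xs) = trans (cong (_+ sumSub (h ∘ (x ∷_)) xs) (sumSub-from₁ h xs)) (+-assoc (h []) _ _)

sumSub-from₂ : (h : List A → ℕ) (xs : List A) → sumSub (from₁ h) xs ≡ sum (map (h ∘ [_]) xs) + sumSub (from₂ h) xs
sumSub-from₂ h []       = refl
sumSub-from₂ h (x ∷ xs) = begin
  sumSub (from₁ h) xs + sumSub (h ∘ (x ∷_)) xs
    ≡⟨ cong₂ _+_ (sumSub-from₂ h xs) (sumSub-from₁ (h ∘ (x ∷_)) xs) ⟩
  (sum (map (h ∘ [_]) xs) + sumSub (from₂ h) xs) + (h [ x ] + sumSub (from₁ (h ∘ (x ∷_))) xs)
    ≡⟨ rearrange (sum (map (h ∘ [_]) xs)) _ (h [ x ]) _ ⟩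
  h [ x ] + sum (map (h ∘ [_]) xs) + (sumSub (from₂ h) xs + sumSub (from₁ (h ∘ (x ∷_))) xs)
    ≡⟨ cong (λ t → h [ x ] + sum (map (h ∘ [_]) xs) + (sumSub (from₂ h) xs + t))
         (sumSub-cong xs λ { [] → refl ; (_ ∷ _) → refl }) ⟩
  h [ x ] + sum (map (h ∘ [_]) xs) + (sumSub (from₂ h) xs + sumSub (from₂ h ∘ (x ∷_)) xs) ∎
  where
  open ≡-Reasoning
  rearrange : ∀ m n o q → (m + n) + (o + q) ≡ o + m + (n + q)
  rearrange = solve-∀

sumSub-from₃ : (h : List A → ℕ) (xs : List A) →
  sumSub (from₂ h) xs ≡ sumPairs (λ x y → h (x ∷ y ∷ [])) xs + sumSub (from₃ h) xs
sumSub-from₃ h []       = refl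
sumSub-from₃ h (x ∷ xs) = begin
  sumSub (from₂ h) xs + sumSub (from₂ h ∘ (x ∷_)) xs
    ≡⟨ cong₂ _+_ (sumSub-from₃ h xs) (sumSub-cong xs λ { [] → refl ; (_ ∷ _) → refl }) ⟩
  (sumPairs k xs + sumSub (from₃ h) xs) + sumSub (from₁ (h ∘ (x ∷_))) xs
    ≡⟨ cong ((sumPairs k xs + sumSub (from₃ h) xs) +_) (sumSub-from₂ (h ∘ (x ∷_)) xs) ⟩
  (sumPairs k xs + sumSub (from₃ h) xs) + (sum (map (k x) xs) + sumSub (from₂ (h ∘ (x ∷_))) xs)
    ≡⟨ rearrange (sumPairs k xs) _ (sum (map (k x) xs)) _ ⟩
  sum (map (k x) xs) + sumPairs k xs + (sumSub (from₃ h) xs + sumSub (from₂ (h ∘ (x ∷_))) xs)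
    ≡⟨ cong (λ t → sum (map (k x) xs) + sumPairs k xs + (sumSub (from₃ h) xs + t))
         (sumSub-cong xs λ { [] → refl ; (_ ∷ []) → refl ; (_ ∷ _ ∷ _) → refl }) ⟩
  sum (map (k x) xs) + sumPairs k xs + (sumSub (from₃ h) xs + sumSub (from₃ h ∘ (x ∷_)) xs) ∎
  where
  open ≡-Reasoning
  k : _ → _ → ℕ
  k x y = h (x ∷ y ∷ [])
  rearrange : ∀ m n o q → (m + n) + (o + q) ≡ o + m + (n + q)
  rearrange = solve-∀

-- The layers are separated because, for families of edges of equal size, the sum over pairs is the
-- first layer that can differ.
sumSub-layers : (h : List A → ℕ) (xs : List A) →
  sumSub h xs ≡ h [] + sum (map (h ∘ [_]) xs) + sumPairs (λ x y → h (x ∷ y ∷ [])) xs + sumSub (from₃ h) xs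
sumSub-layers h xs = begin
  sumSub h xs ≡⟨ sumSub-from₁ h xs ⟩
  h [] + sumSub (from₁ h) xs ≡⟨ cong (h [] +_) (sumSub-from₂ h xs) ⟩
  h [] + (s + sumSub (from₂ h) xs) ≡⟨ cong (λ t → h [] + (s + t)) (sumSub-from₃ h xs) ⟩
  h [] + (s + (q + sumSub (from₃ h) xs)) ≡⟨ rearrange (h []) s q _ ⟩
  h [] + s + q + sumSub (from₃ h) xs ∎
  where
  open ≡-Reasoning
  s = sum (map (h ∘ [_]) xs)
  q = sumPairs (λ x y → h (x ∷ y ∷ [])) xs
  rearrange : ∀ m n o q → m + (n + (o + q)) ≡ m + n + o + q
  rearrange = solve-∀

private variable
  n k s : ℕ

_≟ˢ_ : DecidableEquality (Subset n)
_≟ˢ_ = VecP.≡-dec Bool._≟_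

open module Member {n} = DecMembership (_≟ˢ_ {n}) using (_∈?_)

-- Families with a given trace

-- Splitting by the first coordinate: `allSubsets`, `subsetsOf` and `blocks` are all assembled with
-- `join`, so their lengths and the absence of duplicates come from the same two lemmas.
join : List (Subset n) → List (Subset n) → List (Subset (suc n))
join 𝓧 𝓨 = map (true ∷_) 𝓧 ++ map (false ∷_) 𝓨

module _ {𝓧 𝓨 : List (Subset n)} where

  ∈-join-true⁺ : ∀ {X} → X ∈ 𝓧 → true ∷ X ∈ join 𝓧 𝓨
  ∈-join-true⁺ X∈ = ∈-++⁺ˡ (∈-map⁺ (true ∷_) X∈)

  ∈-join-false⁺ : ∀ {X} → X ∈ 𝓨 → false ∷ X ∈ join 𝓧 𝓨
  ∈-join-false⁺ X∈ = ∈-++⁺ʳ (map (true ∷_) 𝓧) (∈-map⁺ (false ∷_) X∈)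

  ∈-join-true⁻ : ∀ {X} → true ∷ X ∈ join 𝓧 𝓨 → X ∈ 𝓧
  ∈-join-true⁻ X∈ with ∈-++⁻ (map (true ∷_) 𝓧) X∈
  ... | inj₁ X∈𝓧 with ∈-map⁻ (true ∷_) X∈𝓧
  ...   | _ , Y∈ , refl = Y∈
  ∈-join-true⁻ X∈ | inj₂ X∈𝓨 with ∈-map⁻ (false ∷_) X∈𝓨
  ...   | _ , _ , ()

  ∈-join-false⁻ : ∀ {X} → false ∷ X ∈ join 𝓧 𝓨 → X ∈ 𝓨
  ∈-join-false⁻ X∈ with ∈-++⁻ (map (true ∷_) 𝓧) X∈
  ... | inj₂ X∈𝓨 with ∈-map⁻ (false ∷_) X∈𝓨
  ...   | _ , Y∈ , refl = Y∈
  ∈-join-false⁻ X∈ | inj₁ X∈𝓧 with ∈-map⁻ (true ∷_) X∈𝓧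
  ...   | _ , _ , ()

  join-unique : Unique 𝓧 → Unique 𝓨 → Unique (join 𝓧 𝓨)
  join-unique u𝓧 u𝓨 = Uniq.++⁺ (Uniq.map⁺ (λ { refl → refl }) u𝓧) (Uniq.map⁺ (λ { refl → refl }) u𝓨) disjoint
    where
    disjoint : ∀ {X} → ¬ (X ∈ map (true ∷_) 𝓧 × X ∈ map (false ∷_) 𝓨)
    disjoint (X∈ , X∈′) with ∈-map⁻ (true ∷_) X∈ | ∈-map⁻ (false ∷_) X∈′
    ... | _ , _ , refl | _ , _ , ()

length-join : (𝓧 𝓨 : List (Subset n)) → length (join 𝓧 𝓨) ≡ length 𝓧 + length 𝓨
length-join 𝓧 𝓨 = trans (length-++ (map (true ∷_) 𝓧)) (cong₂ _+_ (length-map _ 𝓧) (length-map _ 𝓨))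

2^suc : ∀ {m} → m ≡ 2 ^ n → m + m ≡ 2 ^ suc n
2^suc {m = m} refl = cong (m +_) (sym (+-identityʳ m))

allSubsets : ∀ n → List (Subset n)
allSubsets zero    = [ [] ]
allSubsets (suc n) = join (allSubsets n) (allSubsets n)

∈-allSubsets : (X : Subset n) → X ∈ allSubsets n
∈-allSubsets []          = here refl
∈-allSubsets (true  ∷ X) = ∈-join-true⁺ (∈-allSubsets X)
∈-allSubsets (false ∷ X) = ∈-join-false⁺ (∈-allSubsets X)

allSubsets-unique : ∀ n → Unique (allSubsets n)
allSubsets-unique zero    = [] ∷ []
allSubsets-unique (suc n) = join-unique (allSubsets-unique n) (allSubsets-unique n)

length-allSubsets : ∀ n → length (allSubsets n) ≡ 2 ^ n
length-allSubsets zero    = refl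
length-allSubsets (suc n) = trans (length-join (allSubsets n) (allSubsets n)) (2^suc {n = n} (length-allSubsets n))

large : ∀ n → List (Subset n)
large n = filter (λ X → 3 ≤? ∣ X ∣) (allSubsets n)

∈-large⁺ : {X : Subset n} → 3 ≤ ∣ X ∣ → X ∈ large n
∈-large⁺ {X = X} = ∈-filter⁺ (λ X → 3 ≤? ∣ X ∣) (∈-allSubsets X)

∈-large⁻ : {X : Subset n} → X ∈ large n → 3 ≤ ∣ X ∣
∈-large⁻ {n} X∈ = proj₂ (∈-filter⁻ (λ X → 3 ≤? ∣ X ∣) {xs = allSubsets n} X∈)

large-unique : ∀ n → Unique (large n)
large-unique n = Uniq.filter⁺ (λ X → 3 ≤? ∣ X ∣) (allSubsets-unique n)

admissible? : (s : ℕ) (𝓕 : Family n) → Dec (length 𝓕 ≡ s × Intersecting 𝓕)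
admissible? s 𝓕 = (length 𝓕 ≟ s) ×-dec intersecting? 𝓕

-- When `T` consists of pairs, `G` is the part of size at least three of a family whose trace is
-- `T`; listing `G` alone counts each such family once.
extensions : ℕ → Family n → List (Family n)
extensions {n} s T = filter (λ G → admissible? s (T ++ G)) (sublists (large n))

abstract
  #extensions : ℕ → Family n → ℕ
  #extensions s T = length (extensions s T)

  #extensions≡length : (s : ℕ) (T : Family n) → #extensions s T ≡ length (extensions s T)
  #extensions≡length s T = refl

-- As Boolean functions, families can be transformed by precomposition with a bijection of the power
-- set. Permuting points, taking complements and trading classes of sets all have this shape, and
-- all preserve the number of members by `length-members-∘`.
Indicator : ℕ → Set
Indicator n = Subset n → Bool

_∋_ : Indicator n → Subset n → Set
F ∋ X = F X ≡ true

members : Indicator n → Family n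
members {n} F = filter (λ X → F X Bool.≟ true) (allSubsets n)

∈-members⁺ : {F : Indicator n} {X : Subset n} → F ∋ X → X ∈ members F
∈-members⁺ {F = F} {X} = ∈-filter⁺ (λ X → F X Bool.≟ true) (∈-allSubsets X)

∈-members⁻ : {F : Indicator n} {X : Subset n} → X ∈ members F → F ∋ X
∈-members⁻ {n} {F} X∈ = proj₂ (∈-filter⁻ (λ X → F X Bool.≟ true) {xs = allSubsets n} X∈)

members-unique : (F : Indicator n) → Unique (members F)
members-unique {n} F = Uniq.filter⁺ (λ X → F X Bool.≟ true) (allSubsets-unique n)

length-members-∘ : (F : Indicator n) (φ ψ : Subset n → Subset n) →
  (∀ X → ψ (φ X) ≡ X) → (∀ X → φ (ψ X) ≡ X) → length (members (F ∘ φ)) ≡ length (members F)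
length-members-∘ F φ ψ ψφ φψ = trans
  (↭-length (unique⇒↭ (members-unique (F ∘ φ)) (Uniq.map⁺ ψ-injective (members-unique F)) into onto))
  (length-map ψ (members F))
  where
  ψ-injective : ∀ {X Y} → ψ X ≡ ψ Y → X ≡ Y
  ψ-injective {X} {Y} eq = trans (sym (φψ X)) (trans (cong φ eq) (φψ Y))
  into : ∀ {X} → X ∈ members (F ∘ φ) → X ∈ map ψ (members F)
  into {X} X∈ = subst (_∈ map ψ (members F)) (ψφ X) (∈-map⁺ ψ (∈-members⁺ {F = F} (∈-members⁻ {F = F ∘ φ} X∈)))
  onto : ∀ {X} → X ∈ map ψ (members F) → X ∈ members (F ∘ φ)
  onto X∈ with ∈-map⁻ ψ X∈
  ... | Y , Y∈ , refl = ∈-members⁺ {F = F ∘ φ} (trans (cong F (φψ Y)) (∈-members⁻ {F = F} Y∈))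

-- If `T` consists of pairs, the first two fields together say that `T` is exactly the set of
-- members with fewer than three elements.
record Good (s : ℕ) (T : Family n) (F : Indicator n) : Set where
  field
    large⊎trace : ∀ {X} → F ∋ X → 3 ≤ ∣ X ∣ ⊎ X ∈ T
    trace       : ∀ {X} → X ∈ T → F ∋ X
    meet        : ∀ {X Y} → F ∋ X → F ∋ Y → Nonempty (X ∩ Y)
    size        : length (members F) ≡ s

open Good

Pairs : Family n → Set
Pairs T = Unique T × All (λ X → ∣ X ∣ ≡ 2) T

3≰2 : ¬ 3 ≤ 2
3≰2 (s≤s (s≤s ()))

indicatorOf : Family n → Indicator n
indicatorOf 𝓕 X = does (X ∈? 𝓕)

∈⇒∋ : {𝓕 : Family n} {X : Subset n} → X ∈ 𝓕 → indicatorOf 𝓕 ∋ X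
∈⇒∋ {𝓕 = 𝓕} {X} X∈ = dec-true (X ∈? 𝓕) X∈

∋⇒∈ : {𝓕 : Family n} {X : Subset n} → indicatorOf 𝓕 ∋ X → X ∈ 𝓕
∋⇒∈ {𝓕 = 𝓕} {X} eq with X ∈? 𝓕
... | yes X∈ = X∈
... | no  _  = contradiction eq λ ()

pair∉large : {T : Family n} → Pairs T → ∀ {X} → X ∈ T → ¬ X ∈ large n
pair∉large (_ , two) X∈T X∈large = 3≰2 (subst (3 ≤_) (All.lookup two X∈T) (∈-large⁻ X∈large))

++-unique : {T G : Family n} → Pairs T → Unique G → (∀ {X} → X ∈ G → X ∈ large n) → Unique (T ++ G)
++-unique pairs uG sub = Uniq.++⁺ (proj₁ pairs) uG λ { (X∈T , X∈G) → pair∉large pairs X∈T (sub X∈G) }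

restrict : Indicator n → Family n
restrict {n} F = filter (λ X → F X Bool.≟ true) (large n)

∈-restrict⁻ : {F : Indicator n} {X : Subset n} → X ∈ restrict F → X ∈ large n × F ∋ X
∈-restrict⁻ {n} {F} = ∈-filter⁻ (λ X → F X Bool.≟ true) {xs = large n}

∈-restrict⁺ : {F : Indicator n} {X : Subset n} → X ∈ large n → F ∋ X → X ∈ restrict F
∈-restrict⁺ {F = F} = ∈-filter⁺ (λ X → F X Bool.≟ true)

module _ {T : Family n} (pairs : Pairs T) where

  extension⇒good : ∀ {G} → G ∈ extensions s T → Good s T (indicatorOf (T ++ G))
  extension⇒good {s} {G} G∈ with ∈-filter⁻ (λ G → admissible? s (T ++ G)) {xs = sublists (large n)} G∈
  ... | G∈sub , len , int = record
    { large⊎trace = λ F∋X → classify (∈-++⁻ T (∋⇒∈ F∋X))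
    ; trace       = λ X∈T → ∈⇒∋ (∈-++⁺ˡ X∈T)
    ; meet        = λ F∋X F∋Y → All.lookup (All.lookup int (∋⇒∈ F∋X)) (∋⇒∈ F∋Y)
    ; size        = trans (↭-length (unique⇒↭ (members-unique (indicatorOf (T ++ G)))
                      (++-unique pairs (unique-resp-⊆ G⊆ (large-unique n)) (Any-resp-⊆ G⊆))
                      (λ X∈ → ∋⇒∈ (∈-members⁻ {F = indicatorOf (T ++ G)} X∈))
                      (λ X∈ → ∈-members⁺ {F = indicatorOf (T ++ G)} (∈⇒∋ X∈)))) len
    }
    where
    G⊆ = ∈-sublists⁻ (large n) G∈sub
    classify : ∀ {X} → X ∈ T ⊎ X ∈ G → 3 ≤ ∣ X ∣ ⊎ X ∈ T
    classify (inj₁ X∈T) = inj₂ X∈T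
    classify (inj₂ X∈G) = inj₁ (∈-large⁻ (Any-resp-⊆ G⊆ X∈G))

  good⇒extension : ∀ {F} → Good s T F → restrict F ∈ extensions s T
  good⇒extension {s} {F} good = ∈-filter⁺ (λ G → admissible? s (T ++ G))
    (filter∈sublists (λ X → F X Bool.≟ true) (large n))
    ( trans (↭-length (unique⇒↭
        (++-unique pairs (Uniq.filter⁺ (λ X → F X Bool.≟ true) (large-unique n)) (λ X∈ → proj₁ (∈-restrict⁻ {F = F} X∈)))
        (members-unique F) (λ X∈ → ∈-members⁺ {F = F} (sound X∈)) (λ X∈ → complete (∈-members⁻ {F = F} X∈)))) (size good)
    , All.tabulate (λ X∈ → All.tabulate (λ Y∈ → meet good (sound X∈) (sound Y∈))))
    where
    sound : ∀ {X} → X ∈ T ++ restrict F → F ∋ X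
    sound X∈ with ∈-++⁻ T X∈
    ... | inj₁ X∈T = trace good X∈T
    ... | inj₂ X∈r = proj₂ (∈-restrict⁻ {F = F} X∈r)
    complete : ∀ {X} → F ∋ X → X ∈ T ++ restrict F
    complete F∋X with large⊎trace good F∋X
    ... | inj₁ 3≤ = ∈-++⁺ʳ T (∈-restrict⁺ {F = F} (∈-large⁺ 3≤) F∋X)
    ... | inj₂ X∈T = ∈-++⁺ˡ X∈T

  restrict-indicatorOf : ∀ {G} → G ∈ extensions s T → restrict (indicatorOf (T ++ G)) ≡ G
  restrict-indicatorOf {s} {G} G∈ = sublist≡filter (large-unique n)
    (∈-sublists⁻ (large n) (proj₁ (∈-filter⁻ (λ G → admissible? s (T ++ G)) {xs = sublists (large n)} G∈)))
    (λ X → indicatorOf (T ++ G) X Bool.≟ true)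
    into (λ X∈G → ∈⇒∋ (∈-++⁺ʳ T X∈G))
    where
    into : ∀ {X} → X ∈ large n → indicatorOf (T ++ G) ∋ X → X ∈ G
    into X∈large F∋X with ∈-++⁻ T (∋⇒∈ F∋X)
    ... | inj₁ X∈T = contradiction X∈large (pair∉large pairs X∈T)
    ... | inj₂ X∈G = X∈G

  -- Outside the large sets both families are prescribed by `T`, so agreement on the large sets is
  -- agreement everywhere.
  restrict-injective : ∀ {F F′} → Good s T F → Good s T F′ → restrict F ≡ restrict F′ → ∀ X → F X ≡ F′ X
  restrict-injective {F = F} {F′} good good′ eq X = Bool.⇔→≡ (mk⇔ (transfer good good′ eq) (transfer good′ good (sym eq)))
    where
    transfer : ∀ {F F′} → Good s T F → Good s T F′ → restrict F ≡ restrict F′ → F ∋ X → F′ ∋ X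
    transfer {F = F} {F′} good good′ eq F∋X with large⊎trace good F∋X
    ... | inj₁ 3≤  = proj₂ (∈-restrict⁻ {F = F′} (subst (X ∈_) eq (∈-restrict⁺ {F = F} (∈-large⁺ 3≤) F∋X)))
    ... | inj₂ X∈T = trace good′ X∈T

length-cartesianProduct : ∀ {a b} {A : Set a} {B : Set b} (xs : List A) (ys : List B) →
  length (cartesianProduct xs ys) ≡ length xs * length ys
length-cartesianProduct []       ys = refl
length-cartesianProduct (x ∷ xs) ys = trans (length-++ (map (x ,_) ys))
  (cong₂ _+_ (length-map (x ,_) ys) (length-cartesianProduct xs ys))

map-unique : ∀ {a b} {A : Set a} {B : Set b} (f : A → B) {xs} → Unique xs →
  (∀ {x y} → x ∈ xs → y ∈ xs → f x ≡ f y → x ≡ y) → Unique (map f xs)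
map-unique f []        inj = []
map-unique f {x ∷ xs} (x∉ ∷ u) inj =
  ¬Any⇒All¬ _ fresh ∷ map-unique f u (λ x∈ y∈ → inj (there x∈) (there y∈))
  where
  fresh : ¬ f x ∈ map f xs
  fresh fx∈ with ∈-map⁻ f fx∈
  ... | y , y∈ , eq = All¬⇒¬Any x∉ (subst (_∈ xs) (sym (inj (here refl) (there y∈) eq)) y∈)

-- This is the source of every inequality between values of `#extensions`: pairs of a family with
-- trace `T` and a key are mapped injectively to families with trace `T′`. Symmetries use a single
-- key; in the removal of an edge the key is the set `S`.
#extensions-injection : ∀ {k} {K : Set k} {T T′ : Family n} → Pairs T → Pairs T′ →
  {Ks : List K} → Unique Ks → (Ψ : Indicator n → K → Indicator n) →
  (∀ {F κ} → Good s T F → κ ∈ Ks → Good s T′ (Ψ F κ)) →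
  (∀ {F F′ κ κ′} → Good s T F → Good s T F′ → κ ∈ Ks → κ′ ∈ Ks → (∀ X → Ψ F κ X ≡ Ψ F′ κ′ X) →
    κ ≡ κ′ × (∀ X → F X ≡ F′ X)) →
  #extensions s T * length Ks ≤ #extensions s T′
#extensions-injection {n} {s} {T = T} {T′} pairs pairs′ {Ks} uKs Ψ good inj = begin
  #extensions s T * length Ks
    ≡⟨ cong (_* length Ks) (#extensions≡length s T) ⟩
  length (extensions s T) * length Ks
    ≡⟨ length-cartesianProduct (extensions s T) Ks ⟨
  length (cartesianProduct (extensions s T) Ks)
    ≡⟨ length-map f (cartesianProduct (extensions s T) Ks) ⟨
  length (map f (cartesianProduct (extensions s T) Ks))
    ≤⟨ length-mono-∈
         (map-unique f
           (Uniq.cartesianProduct⁺ (Uniq.filter⁺ (λ G → admissible? s (T ++ G)) (sublists-unique (large-unique n))) uKs)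
           f-injective)
         into ⟩
  length (extensions s T′)
    ≡⟨ #extensions≡length s T′ ⟨
  #extensions s T′ ∎
  where
  open ℕP.≤-Reasoning
  f = λ (G , κ) → restrict (Ψ (indicatorOf (T ++ G)) κ)
  into : ∀ {G} → G ∈ map f (cartesianProduct (extensions s T) Ks) → G ∈ extensions s T′
  into G∈ with ∈-map⁻ f G∈
  ... | (H , κ) , H,κ∈ , refl with ∈-cartesianProduct⁻ (extensions s T) Ks H,κ∈
  ...   | H∈ , κ∈ = good⇒extension pairs′ (good (extension⇒good pairs H∈) κ∈)
  f-injective : ∀ {p q} → p ∈ cartesianProduct (extensions s T) Ks → q ∈ cartesianProduct (extensions s T) Ks →
    f p ≡ f q → p ≡ q
  f-injective {G , κ} {G′ , κ′} p∈ q∈ eq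
    with ∈-cartesianProduct⁻ (extensions s T) Ks p∈ | ∈-cartesianProduct⁻ (extensions s T) Ks q∈
  ... | G∈ , κ∈ | G′∈ , κ′∈
    with inj (extension⇒good pairs G∈) (extension⇒good pairs G′∈) κ∈ κ′∈
         (restrict-injective pairs′ (good (extension⇒good pairs G∈) κ∈) (good (extension⇒good pairs G′∈) κ′∈) eq)
  ... | refl , F≗F′ = cong (_, κ) (trans (sym (restrict-indicatorOf pairs G∈))
    (trans (filter-cong F≗F′ (large n)) (restrict-indicatorOf pairs G′∈)))
    where
    filter-cong : ∀ {F F′ : Indicator n} → (∀ X → F X ≡ F′ X) → ∀ 𝓕 →
      filter (λ X → F X Bool.≟ true) 𝓕 ≡ filter (λ X → F′ X Bool.≟ true) 𝓕
    filter-cong F≗F′ = filter-≐ _ _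
      ((λ {X} F∋X → trans (sym (F≗F′ X)) F∋X) , (λ {X} F∋X → trans (F≗F′ X) F∋X))

nonempty⇒0<∣p∣ : {p : Subset n} → Nonempty p → 0 < ∣ p ∣
nonempty⇒0<∣p∣ {p = p} (x , x∈p) = subst (_≤ ∣ p ∣) (∣⁅x⁆∣≡1 x)
  (p⊆q⇒∣p∣≤∣q∣ λ y∈ → subst (Sub._∈ p) (sym (x∈⁅y⁆⇒x≡y x y∈)) x∈p)

0<∣p∣⇒nonempty : {p : Subset n} → 0 < ∣ p ∣ → Nonempty p
0<∣p∣⇒nonempty {p = true  ∷ p} _  = zero , Vec.here
0<∣p∣⇒nonempty {p = false ∷ p} 0< with 0<∣p∣⇒nonempty {p = p} 0<
... | x , x∈p = suc x , Vec.there x∈p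

-- Invariance under permutations of the points

-- Only the action of a permutation on subsets is recorded, with the two properties that the
-- counting needs, sizes and intersections.
record Symmetry (n : ℕ) : Set where
  field
    to from : Subset n → Subset n
    from∘to : ∀ X → from (to X) ≡ X
    to∘from : ∀ X → to (from X) ≡ X
    ∣to∣    : ∀ X → ∣ to X ∣ ≡ ∣ X ∣
    to-∩    : ∀ X Y → to (X ∩ Y) ≡ to X ∩ to Y

open Symmetry

invert : Symmetry n → Symmetry n
invert σ = record
  { to = from σ ; from = to σ ; from∘to = to∘from σ ; to∘from = from∘to σ
  ; ∣to∣ = λ X → trans (sym (∣to∣ σ (from σ X))) (cong ∣_∣ (to∘from σ X))
  ; to-∩ = λ X Y → trans (cong₂ (λ X Y → from σ (X ∩ Y)) (sym (to∘from σ X)) (sym (to∘from σ Y)))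
                     (trans (cong (from σ) (sym (to-∩ σ (from σ X) (from σ Y)))) (from∘to σ _))
  }

_then_ : Symmetry n → Symmetry n → Symmetry n
σ then τ = record
  { to = to τ ∘ to σ ; from = from σ ∘ from τ
  ; from∘to = λ X → trans (cong (from σ) (from∘to τ _)) (from∘to σ X)
  ; to∘from = λ X → trans (cong (to τ) (to∘from σ _)) (to∘from τ X)
  ; ∣to∣ = λ X → trans (∣to∣ τ _) (∣to∣ σ X)
  ; to-∩ = λ X Y → trans (cong (to τ) (to-∩ σ X Y)) (to-∩ τ _ _)
  }

∣b∷p∣≡ : ∀ b (p : Subset n) → ∣ b ∷ p ∣ ≡ (if b then 1 else 0) + ∣ p ∣
∣b∷p∣≡ true  p = refl
∣b∷p∣≡ false p = refl

under : Symmetry n → Symmetry (suc n)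
under σ = record
  { to = λ { (b ∷ X) → b ∷ to σ X } ; from = λ { (b ∷ X) → b ∷ from σ X }
  ; from∘to = λ { (b ∷ X) → cong (b ∷_) (from∘to σ X) }
  ; to∘from = λ { (b ∷ X) → cong (b ∷_) (to∘from σ X) }
  ; ∣to∣ = λ { (b ∷ X) → trans (∣b∷p∣≡ b (to σ X)) (trans (cong ((if b then 1 else 0) +_) (∣to∣ σ X)) (sym (∣b∷p∣≡ b X))) }
  ; to-∩ = λ { (b ∷ X) (c ∷ Y) → cong (b ∧ c ∷_) (to-∩ σ X Y) }
  }

∣lookup∷removeAt∣ : (X : Subset (suc n)) (v : Fin (suc n)) → ∣ lookup X v ∷ removeAt X v ∣ ≡ ∣ X ∣
∣lookup∷removeAt∣ (b ∷ X)       zero    = refl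
∣lookup∷removeAt∣ (b ∷ X@(_ ∷ _)) (suc v) = begin
  ∣ lookup X v ∷ b ∷ removeAt X v ∣
    ≡⟨ ∣b∷p∣≡ (lookup X v) (b ∷ removeAt X v) ⟩
  (if lookup X v then 1 else 0) + ∣ b ∷ removeAt X v ∣
    ≡⟨ cong ((if lookup X v then 1 else 0) +_) (∣b∷p∣≡ b (removeAt X v)) ⟩
  (if lookup X v then 1 else 0) + ((if b then 1 else 0) + ∣ removeAt X v ∣)
    ≡⟨ ℕP.+-assoc (if lookup X v then 1 else 0) _ _ ⟨
  (if lookup X v then 1 else 0) + (if b then 1 else 0) + ∣ removeAt X v ∣
    ≡⟨ cong (_+ ∣ removeAt X v ∣) (ℕP.+-comm (if lookup X v then 1 else 0) _) ⟩
  (if b then 1 else 0) + (if lookup X v then 1 else 0) + ∣ removeAt X v ∣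
    ≡⟨ ℕP.+-assoc (if b then 1 else 0) _ _ ⟩
  (if b then 1 else 0) + ((if lookup X v then 1 else 0) + ∣ removeAt X v ∣)
    ≡⟨ cong ((if b then 1 else 0) +_) (trans (sym (∣b∷p∣≡ (lookup X v) (removeAt X v))) (∣lookup∷removeAt∣ X v)) ⟩
  (if b then 1 else 0) + ∣ X ∣
    ≡⟨ ∣b∷p∣≡ b X ⟨
  ∣ b ∷ X ∣ ∎
  where open ≡-Reasoning

removeAt-∩ : (X Y : Subset (suc n)) (v : Fin (suc n)) → removeAt (X ∩ Y) v ≡ removeAt X v ∩ removeAt Y v
removeAt-∩ (b ∷ X) (c ∷ Y) zero = refl
removeAt-∩ (b ∷ X@(_ ∷ _)) (c ∷ Y@(_ ∷ _)) (suc v) = cong (b ∧ c ∷_) (removeAt-∩ X Y v)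

-- The cyclic permutation that carries `v` to the first position and moves the points before it up
-- by one.
bringToFront : Fin (suc n) → Symmetry (suc n)
bringToFront v = record
  { to = λ X → lookup X v ∷ removeAt X v
  ; from = λ { (b ∷ Y) → insertAt Y v b }
  ; from∘to = λ X → VecP.insertAt-removeAt X v
  ; to∘from = λ { (b ∷ Y) → cong₂ _∷_ (VecP.insertAt-lookup Y v b) (VecP.removeAt-insertAt Y v b) }
  ; ∣to∣ = λ X → ∣lookup∷removeAt∣ X v
  ; to-∩ = λ X Y → cong₂ _∷_ (VecP.lookup-zipWith _∧_ v X Y) (removeAt-∩ X Y v)
  }

to-injective : (σ : Symmetry n) → ∀ {X Y} → to σ X ≡ to σ Y → X ≡ Y
to-injective σ {X} {Y} eq = trans (sym (from∘to σ X)) (trans (cong (from σ) eq) (from∘to σ Y))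

-- A `Symmetry` gives no map on points, so nonemptiness is transported through the cardinality of
-- the intersection.
to-meet : (σ : Symmetry n) → ∀ {X Y} → Nonempty (X ∩ Y) → Nonempty (to σ X ∩ to σ Y)
to-meet σ {X} {Y} ne = 0<∣p∣⇒nonempty
  (subst (0 <_) (trans (sym (∣to∣ σ (X ∩ Y))) (cong ∣_∣ (to-∩ σ X Y))) (nonempty⇒0<∣p∣ ne))

map-pairs : (σ : Symmetry n) {T : Family n} → Pairs T → Pairs (map (to σ) T)
map-pairs σ {T} (u , two) = Uniq.map⁺ (to-injective σ) u , All.tabulate two′
  where
  two′ : ∀ {X} → X ∈ map (to σ) T → ∣ X ∣ ≡ 2
  two′ X∈ with ∈-map⁻ (to σ) X∈
  ... | Y , Y∈ , refl = trans (∣to∣ σ Y) (All.lookup two Y∈)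

good-∘from : (σ : Symmetry n) {T : Family n} {F : Indicator n} → Good s T F → Good s (map (to σ) T) (F ∘ from σ)
good-∘from σ {T} {F} good = record
  { large⊎trace = λ {X} F∋ → classify X (large⊎trace good F∋)
  ; trace       = λ X∈ → traced (∈-map⁻ (to σ) X∈)
  ; meet        = λ {X} {Y} F∋X F∋Y →
      subst₂ (λ X Y → Nonempty (X ∩ Y)) (to∘from σ X) (to∘from σ Y) (to-meet σ (meet good F∋X F∋Y))
  ; size        = trans (length-members-∘ F (from σ) (to σ) (to∘from σ) (from∘to σ)) (size good)
  }
  where
  classify : ∀ X → 3 ≤ ∣ from σ X ∣ ⊎ from σ X ∈ T → 3 ≤ ∣ X ∣ ⊎ X ∈ map (to σ) T
  classify X (inj₁ 3≤)  = inj₁ (subst (3 ≤_) (∣to∣ (invert σ) X) 3≤)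
  classify X (inj₂ X∈T) = inj₂ (subst (_∈ map (to σ) T) (to∘from σ X) (∈-map⁺ (to σ) X∈T))
  traced : ∀ {X} → ∃[ Y ] Y ∈ T × X ≡ to σ Y → F ∋ from σ X
  traced (Y , Y∈ , refl) = trans (cong F (from∘to σ Y)) (trace good Y∈)

#extensions-≤-map : (σ : Symmetry n) {T : Family n} → Pairs T → #extensions s T ≤ #extensions s (map (to σ) T)
#extensions-≤-map {s = s} σ {T} pairs = ≤-trans (≤-reflexive (sym (*-identityʳ _)))
  (#extensions-injection pairs (map-pairs σ pairs) {Ks = [ tt ]} ([] ∷ []) (λ F _ → F ∘ from σ)
    (λ good _ → good-∘from σ good)
    (λ {F} {F′} _ _ _ _ eq → refl , λ X → trans (cong F (sym (from∘to σ X))) (trans (eq (to σ X)) (cong F′ (from∘to σ X)))))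

#extensions-map : (σ : Symmetry n) {T : Family n} → Pairs T → #extensions s (map (to σ) T) ≡ #extensions s T
#extensions-map {s = s} σ {T} pairs = ≤-antisym
  (≤-trans (#extensions-≤-map (invert σ) (map-pairs σ pairs)) (≤-reflexive (cong (#extensions s)
    (trans (sym (map-∘ T)) (trans (map-cong (from∘to σ) T) (map-id T))))))
  (#extensions-≤-map σ pairs)

private variable
  F F′ : Indicator n

-- Removing an edge from the trace

subsetsOf : Subset n → List (Subset n)
subsetsOf []          = [ [] ]
subsetsOf (true  ∷ D) = join (subsetsOf D) (subsetsOf D)
subsetsOf (false ∷ D) = join [] (subsetsOf D)

∈-subsetsOf⁻ : (D : Subset n) {S : Subset n} → S ∈ subsetsOf D → S ⊑ D
∈-subsetsOf⁻ (true ∷ D)  {true ∷ S}  S∈ Vec.here       = Vec.here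
∈-subsetsOf⁻ (true ∷ D)  {true ∷ S}  S∈ (Vec.there x∈) = Vec.there (∈-subsetsOf⁻ D (∈-join-true⁻ S∈) x∈)
∈-subsetsOf⁻ (true ∷ D)  {false ∷ S} S∈ (Vec.there x∈) = Vec.there (∈-subsetsOf⁻ D (∈-join-false⁻ {𝓧 = subsetsOf D} S∈) x∈)
∈-subsetsOf⁻ (false ∷ D) {true ∷ S}  S∈ x∈             = contradiction (∈-join-true⁻ {𝓧 = []} S∈) λ ()
∈-subsetsOf⁻ (false ∷ D) {false ∷ S} S∈ (Vec.there x∈) = Vec.there (∈-subsetsOf⁻ D (∈-join-false⁻ {𝓧 = []} S∈) x∈)

subsetsOf-unique : (D : Subset n) → Unique (subsetsOf D)
subsetsOf-unique []          = [] ∷ []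
subsetsOf-unique (true ∷ D)  = join-unique (subsetsOf-unique D) (subsetsOf-unique D)
subsetsOf-unique (false ∷ D) = join-unique [] (subsetsOf-unique D)

length-subsetsOf : (D : Subset n) → length (subsetsOf D) ≡ 2 ^ ∣ D ∣
length-subsetsOf []          = refl
length-subsetsOf (true ∷ D)  = trans (length-join (subsetsOf D) (subsetsOf D)) (2^suc {n = ∣ D ∣} (length-subsetsOf D))
length-subsetsOf (false ∷ D) = trans (length-join [] (subsetsOf D)) (length-subsetsOf D)

∁-involutive : (p : Subset n) → ∁ (∁ p) ≡ p
∁-involutive []      = refl
∁-involutive (b ∷ p) = cong₂ _∷_ (Bool.not-involutive b) (∁-involutive p)

∁-⊑-swap : {p q : Subset n} → ∁ p ⊑ q → ∁ q ⊑ p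
∁-⊑-swap {p = p} {q} ∁p⊑q x∈∁q = subst (_ Sub.∈_) (∁-involutive p) (p⊆q⇒∁p⊇∁q ∁p⊑q x∈∁q)

disjoint⇒⊑∁ : {p q : Subset n} → ¬ Nonempty (p ∩ q) → p ⊑ ∁ q
disjoint⇒⊑∁ ¬ne x∈p = x∉p⇒x∈∁p λ x∈q → ¬ne (_ , x∈p∩q⁺ (x∈p , x∈q))

∣p∣≡0⇒p≡⊥ : {p : Subset n} → ∣ p ∣ ≡ 0 → p ≡ ⊥
∣p∣≡0⇒p≡⊥ {p = p} ∣p∣≡0 = SubP.Empty-unique λ ne → contradiction (subst (0 <_) ∣p∣≡0 (nonempty⇒0<∣p∣ ne)) λ ()

exchange : Subset n → Subset n → Subset n
exchange S Y = if does (Y ≟ˢ ⊥) then S else (if does (Y ≟ˢ S) then ⊥ else Y)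

exchange-⊥ : (S : Subset n) → exchange S ⊥ ≡ S
exchange-⊥ {n} S rewrite dec-true (⊥ {n} ≟ˢ ⊥) refl = refl

exchange-self : (S : Subset n) → exchange S S ≡ ⊥
exchange-self S with S ≟ˢ ⊥
... | yes S≡⊥ = S≡⊥
... | no  _   rewrite dec-true (S ≟ˢ S) refl = refl

exchange-involutive : (S Y : Subset n) → exchange S (exchange S Y) ≡ Y
exchange-involutive S Y with Y ≟ˢ ⊥
... | yes refl = exchange-self S
... | no  Y≢⊥ with Y ≟ˢ S
...   | yes refl = exchange-⊥ S
...   | no  Y≢S rewrite dec-false (Y ≟ˢ ⊥) Y≢⊥ | dec-false (Y ≟ˢ S) Y≢S = refl

exchange-⊑ : {S Y : Subset n} → Y ⊑ S → exchange S Y ⊑ S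
exchange-⊑ {S = S} {Y} Y⊑S with Y ≟ˢ ⊥
... | yes _ = λ x∈ → x∈
... | no  _ with Y ≟ˢ S
...   | yes _ = λ x∈ → contradiction x∈ ∉⊥
...   | no  _ = Y⊑S

-- The members of a family that lie between the edge {0,1} and {0,1} ∪ S are
-- replaced by their complements; exchanging ∅ and S first makes {0,1} ∪ S
-- the largest set whose complement is present afterwards, so S can be read off.
flip : Subset k → Subset (2 + k) → Subset (2 + k)
flip S (true  ∷ true  ∷ Y) = if does (Y ⊆? S) then false ∷ false ∷ ∁ (exchange S Y) else true ∷ true ∷ Y
flip S (false ∷ false ∷ Y) = if does (∁ Y ⊆? S) then true ∷ true ∷ exchange S (∁ Y) else false ∷ false ∷ Y
flip S (b ∷ c ∷ Y)         = b ∷ c ∷ Y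

flip-involutive : (S : Subset k) (X : Subset (2 + k)) → flip S (flip S X) ≡ X
flip-involutive S (true ∷ false ∷ Y) = refl
flip-involutive S (false ∷ true ∷ Y) = refl
flip-involutive S (true ∷ true ∷ Y) with Y ⊆? S
... | no Y⋢S rewrite dec-false (Y ⊆? S) Y⋢S = refl
... | yes Y⊑S
  rewrite dec-true (∁ (∁ (exchange S Y)) ⊆? S) (subst (_⊑ S) (sym (∁-involutive (exchange S Y))) (exchange-⊑ Y⊑S))
  = cong (λ Z → true ∷ true ∷ Z) (trans (cong (exchange S) (∁-involutive (exchange S Y))) (exchange-involutive S Y))
flip-involutive S (false ∷ false ∷ Y) with ∁ Y ⊆? S
... | no ∁Y⋢S rewrite dec-false (∁ Y ⊆? S) ∁Y⋢S = refl
... | yes ∁Y⊑S rewrite dec-true (exchange S (∁ Y) ⊆? S) (exchange-⊑ ∁Y⊑S)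
  = cong (λ Z → false ∷ false ∷ Z) (trans (cong ∁ (exchange-involutive S (∁ Y))) (∁-involutive Y))

edge : Subset (2 + k)
edge = true ∷ true ∷ ⊥

lift-nonempty : ∀ {b c} {p : Subset k} → Nonempty p → Nonempty (b ∷ c ∷ p)
lift-nonempty (x , x∈p) = suc (suc x) , Vec.there (Vec.there x∈p)

lower-nonempty : {p : Subset k} → Nonempty (false ∷ false ∷ p) → Nonempty p
lower-nonempty (suc (suc x) , Vec.there (Vec.there x∈p)) = x , x∈p

-- Sets missing both ends of the edge are absent before a flip. They are therefore free to receive
-- complements, and any that is present afterwards must have been put there by the flip.
¬∋00 : {T : Family (2 + k)} → Good s (edge ∷ T) F → ∀ {Y} → ¬ F ∋ (false ∷ false ∷ Y)
¬∋00 {k} good {Y} F∋ with lower-nonempty (meet good (trace good (here refl)) F∋)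
... | x , x∈ = ∉⊥ (proj₁ (x∈p∩q⁻ ⊥ Y x∈))

-- The complements that a flip inserts all contain `∁ S`, so the first condition makes them large.
-- The second one cannot be avoided: since `edge` is a member, the complement of `edge ∪ S` gets
-- inserted, and it is disjoint from the excluded sets.
Flippable : Subset k → Indicator (2 + k) → Set
Flippable S F = 3 ≤ ∣ ∁ S ∣ × (∀ {Y} → Y ⊑ S → ¬ F ∋ (true ∷ false ∷ Y) × ¬ F ∋ (false ∷ true ∷ Y))

flip-good : {T : Family (2 + k)} {S : Subset k} → Pairs (edge ∷ T) → Good s (edge ∷ T) F → Flippable S F →
  Good s T (F ∘ flip S)
flip-good {k} {F = F} {T} {S} ((edge∉T ∷ _) , (_ ∷ two)) good (3≤∣∁S∣ , flippable) = record
  { large⊎trace = λ {X} → large⊎trace′ X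
  ; trace       = λ {X} → trace′ X
  ; meet        = λ {X} {Y} → meet′ X Y
  ; size        = trans (length-members-∘ F (flip S) (flip S) (flip-involutive S) (flip-involutive S)) (size good)
  }
  where
  T-only : ∀ {X} → ¬ X ≡ edge → 3 ≤ ∣ X ∣ ⊎ X ∈ edge ∷ T → 3 ≤ ∣ X ∣ ⊎ X ∈ T
  T-only X≢ (inj₁ 3≤)           = inj₁ 3≤
  T-only X≢ (inj₂ (here X≡))    = contradiction X≡ X≢
  T-only X≢ (inj₂ (there X∈))   = inj₂ X∈

  11⇒⋢ : ∀ {Y} → (F ∘ flip S) ∋ (true ∷ true ∷ Y) → ¬ Y ⊑ S × F ∋ (true ∷ true ∷ Y)
  11⇒⋢ {Y} F∋ with Y ⊆? S
  ... | yes _   = contradiction F∋ (¬∋00 good)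
  ... | no  Y⋢S = Y⋢S , F∋

  00⇒⊑ : ∀ {Y} → (F ∘ flip S) ∋ (false ∷ false ∷ Y) → ∁ Y ⊑ S
  00⇒⊑ {Y} F∋ with ∁ Y ⊆? S
  ... | yes ∁Y⊑S = ∁Y⊑S
  ... | no  _    = contradiction F∋ (¬∋00 good)

  large⊎trace′ : ∀ X → (F ∘ flip S) ∋ X → 3 ≤ ∣ X ∣ ⊎ X ∈ T
  large⊎trace′ (true ∷ false ∷ Y) F∋  = T-only (λ ()) (large⊎trace good F∋)
  large⊎trace′ (false ∷ true ∷ Y) F∋  = T-only (λ ()) (large⊎trace good F∋)
  large⊎trace′ (true ∷ true ∷ Y) F∋   with 11⇒⋢ F∋
  -- The edge itself has `Y = ⊥`, which lies in every `S`, so it is among the sets that were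
  -- replaced and leaves the trace.
  ... | Y⋢S , F∋′ = T-only (λ { refl → Y⋢S ⊥⊆ }) (large⊎trace good F∋′)
  large⊎trace′ (false ∷ false ∷ Y) F∋ = inj₁ (≤-trans 3≤∣∁S∣ (p⊆q⇒∣p∣≤∣q∣ (∁-⊑-swap (00⇒⊑ F∋))))

  trace′ : ∀ X → X ∈ T → (F ∘ flip S) ∋ X
  trace′ (true ∷ false ∷ Y) X∈  = trace good (there X∈)
  trace′ (false ∷ true ∷ Y) X∈  = trace good (there X∈)
  trace′ (false ∷ false ∷ Y) X∈ = contradiction (trace good (there X∈)) (¬∋00 good)
  trace′ (true ∷ true ∷ Y) X∈   = contradiction X∈ (λ X∈ → All¬⇒¬Any edge∉T (subst (_∈ T) X≡edge X∈))
    where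
    X≡edge : true ∷ true ∷ Y ≡ edge
    X≡edge = cong (λ Z → true ∷ true ∷ Z) (∣p∣≡0⇒p≡⊥ (ℕP.suc-injective (ℕP.suc-injective (All.lookup two X∈))))

  -- If `Y` and `Z` were disjoint, then `Y ⊑ ∁ Z ⊑ S`.
  outside-meets : ∀ {Y Z} → ¬ Y ⊑ S → ∁ Z ⊑ S → Nonempty (Y ∩ Z)
  outside-meets {Y} {Z} Y⋢S ∁Z⊑S with nonempty? (Y ∩ Z)
  ... | yes ne = ne
  ... | no ¬ne = contradiction (λ {x} x∈ → ∁Z⊑S (disjoint⇒⊑∁ ¬ne x∈)) Y⋢S

  meet-00 : ∀ X Z → (F ∘ flip S) ∋ X → (F ∘ flip S) ∋ (false ∷ false ∷ Z) → Nonempty (X ∩ (false ∷ false ∷ Z))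
  meet-00 (true ∷ true ∷ Y) Z F∋Y F∋Z   = lift-nonempty (outside-meets (proj₁ (11⇒⋢ F∋Y)) (00⇒⊑ F∋Z))
  meet-00 (true ∷ false ∷ Y) Z F∋Y F∋Z  = lift-nonempty (outside-meets (λ Y⊑S → proj₁ (flippable {Y} Y⊑S) F∋Y) (00⇒⊑ F∋Z))
  meet-00 (false ∷ true ∷ Y) Z F∋Y F∋Z  = lift-nonempty (outside-meets (λ Y⊑S → proj₂ (flippable {Y} Y⊑S) F∋Y) (00⇒⊑ F∋Z))
  meet-00 (false ∷ false ∷ Y) Z F∋Y F∋Z with 0<∣p∣⇒nonempty {p = ∁ S} (≤-trans (s≤s z≤n) 3≤∣∁S∣)
  -- Two inserted complements share all of `∁ S`.
  ... | x , x∈ = lift-nonempty (x , x∈p∩q⁺ (∁-⊑-swap (00⇒⊑ F∋Y) x∈ , ∁-⊑-swap (00⇒⊑ F∋Z) x∈))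

  meet′ : ∀ X Y → (F ∘ flip S) ∋ X → (F ∘ flip S) ∋ Y → Nonempty (X ∩ Y)
  meet′ X (false ∷ false ∷ Z) F∋X F∋Y = meet-00 X Z F∋X F∋Y
  meet′ (false ∷ false ∷ Z) Y F∋X F∋Y = subst Nonempty (∩-comm Y (false ∷ false ∷ Z)) (meet-00 Y Z F∋Y F∋X)
  meet′ (true ∷ _) (true ∷ _) F∋X F∋Y = zero , Vec.here
  meet′ (_ ∷ true ∷ _) (_ ∷ true ∷ _) F∋X F∋Y = suc zero , Vec.there Vec.here
  meet′ (true ∷ false ∷ _) (false ∷ true ∷ _) F∋X F∋Y = meet good F∋X F∋Y
  meet′ (false ∷ true ∷ _) (true ∷ false ∷ _) F∋X F∋Y = meet good F∋X F∋Y

-- The first family contains `∁ S` after the flip, because `exchange` sends `S` to `⊥` and `edge` is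
-- a member. In the second family a set missing both ends can only come from a flip by `S′`, whose
-- complements all have their own complement inside `S′`.
flip-reads : {T : Family (2 + k)} {S S′ : Subset k} → Good s (edge ∷ T) F → Good s (edge ∷ T) F′ →
  (∀ X → F (flip S X) ≡ F′ (flip S′ X)) → S ⊑ S′
flip-reads {k} {F = F} {F′} {T} {S} {S′} good good′ eq =
  subst (_⊑ S′) (∁-involutive S) (00⇒⊑ (trans (sym (eq (false ∷ false ∷ ∁ S))) F∋))
  where
  F∋ : F (flip S (false ∷ false ∷ ∁ S)) ≡ true
  F∋ rewrite ∁-involutive S | dec-true (S ⊆? S) (λ x∈ → x∈) | exchange-self S = trace good (here refl)
  00⇒⊑ : F′ (flip S′ (false ∷ false ∷ ∁ S)) ≡ true → ∁ (∁ S) ⊑ S′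
  00⇒⊑ F′∋ with ∁ (∁ S) ⊆? S′
  ... | yes ∁∁S⊑S′ = ∁∁S⊑S′
  ... | no  _      = contradiction F′∋ (¬∋00 good′)

flip-injective : {T : Family (2 + k)} {S S′ : Subset k} → Good s (edge ∷ T) F → Good s (edge ∷ T) F′ →
  (∀ X → F (flip S X) ≡ F′ (flip S′ X)) → S ≡ S′ × (∀ X → F X ≡ F′ X)
flip-injective {F = F} {F′} {S = S} {S′} good good′ eq
  with ⊆-antisym {i = S} {S′} (flip-reads {S = S} {S′} good good′ eq) (flip-reads {S = S′} {S} good′ good (sym ∘ eq))
... | refl = refl , λ X → begin
  F X                 ≡⟨ cong F (flip-involutive S X) ⟨
  F (flip S (flip S X)) ≡⟨ eq (flip S X) ⟩
  F′ (flip S (flip S X)) ≡⟨ cong F′ (flip-involutive S X) ⟩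
  F′ X ∎
  where open ≡-Reasoning

flip-bound : {T : Family (2 + k)} → Pairs (edge ∷ T) → {Ss : List (Subset k)} → Unique Ss →
  (∀ {F S} → Good s (edge ∷ T) F → S ∈ Ss → Flippable S F) →
  #extensions s (edge ∷ T) * length Ss ≤ #extensions s T
flip-bound pairs@((_ ∷ u) , (_ ∷ two)) uSs flippable = #extensions-injection pairs (u , two) uSs (λ F S → F ∘ flip S)
  (λ good S∈ → flip-good pairs good (flippable good S∈))
  (λ good good′ _ _ → flip-injective good good′)

-- Removing an edge from a star with centre 0 and leaves 1 and `R`

record Star (T : Family (2 + k)) (R : Subset k) : Set where
  field
    sound    : ∀ {X} → X ∈ T → ∃[ r ] r Sub.∈ R × X ≡ true ∷ false ∷ ⁅ r ⁆
    complete : ∀ {r} → r Sub.∈ R → true ∷ false ∷ ⁅ r ⁆ ∈ T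

open Star

-- For Y and Z disjoint from R, the sets {0} ∪ Y and {1} ∪ Z ∪ R meet exactly when
-- Y and Z do, so these two classes of sets can trade places.
swap : Subset k → Subset (2 + k) → Subset (2 + k)
swap R (true  ∷ false ∷ Y) = if does (Y ⊆? ∁ R) then false ∷ true ∷ (Y ∪ R) else true ∷ false ∷ Y
swap R (false ∷ true  ∷ Y) = if does (R ⊆? Y) then true ∷ false ∷ (Y ∩ ∁ R) else false ∷ true ∷ Y
swap R (b ∷ c ∷ Y)         = b ∷ c ∷ Y

∪-∩∁ : {Y R : Subset k} → Y ⊑ ∁ R → (Y ∪ R) ∩ ∁ R ≡ Y
∪-∩∁ {Y = Y} {R} Y⊑∁R = ⊆-antisym into (λ x∈ → x∈p∩q⁺ (x∈p∪q⁺ (inj₁ x∈) , Y⊑∁R x∈))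
  where
  into : (Y ∪ R) ∩ ∁ R ⊑ Y
  into x∈ with x∈p∩q⁻ (Y ∪ R) (∁ R) x∈
  ... | x∈∪ , x∈∁R with x∈p∪q⁻ Y R x∈∪
  ...   | inj₁ x∈Y = x∈Y
  ...   | inj₂ x∈R = contradiction x∈R (x∈∁p⇒x∉p x∈∁R)

∩∁-∪ : {Y R : Subset k} → R ⊑ Y → (Y ∩ ∁ R) ∪ R ≡ Y
∩∁-∪ {Y = Y} {R} R⊑Y = ⊆-antisym into onto
  where
  into : (Y ∩ ∁ R) ∪ R ⊑ Y
  into x∈ with x∈p∪q⁻ (Y ∩ ∁ R) R x∈
  ... | inj₁ x∈∩ = p∩q⊆p Y (∁ R) x∈∩
  ... | inj₂ x∈R = R⊑Y x∈R
  onto : Y ⊑ (Y ∩ ∁ R) ∪ R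
  onto {x} x∈ with x SubP.∈? R
  ... | yes x∈R = x∈p∪q⁺ (inj₂ x∈R)
  ... | no  x∉R = x∈p∪q⁺ (inj₁ (x∈p∩q⁺ (x∈ , x∉p⇒x∈∁p x∉R)))

swap-involutive : (R : Subset k) (X : Subset (2 + k)) → swap R (swap R X) ≡ X
swap-involutive R (true ∷ true ∷ Y)   = refl
swap-involutive R (false ∷ false ∷ Y) = refl
swap-involutive R (true ∷ false ∷ Y) with Y ⊆? ∁ R
... | no  Y⋢ rewrite dec-false (Y ⊆? ∁ R) Y⋢ = refl
... | yes Y⊑ rewrite dec-true (R ⊆? (Y ∪ R)) (λ x∈ → x∈p∪q⁺ (inj₂ x∈)) = cong (λ Z → true ∷ false ∷ Z) (∪-∩∁ Y⊑)
swap-involutive R (false ∷ true ∷ Y) with R ⊆? Y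
... | no  R⋢ rewrite dec-false (R ⊆? Y) R⋢ = refl
... | yes R⊑ rewrite dec-true ((Y ∩ ∁ R) ⊆? ∁ R) (p∩q⊆q Y (∁ R)) = cong (λ Z → false ∷ true ∷ Z) (∩∁-∪ R⊑)

module _ {T : Family (2 + k)} {R : Subset k} (star : Star T R) where

  -- A member without the centre can meet the edge from 0 to `r` only in `r`.
  01⇒R⊑ : Good s (edge ∷ T) F → ∀ {Y} → F ∋ (false ∷ true ∷ Y) → R ⊑ Y
  01⇒R⊑ good {Y} F∋ {r} r∈R with lower-nonempty (meet good (trace good (there (complete star r∈R))) F∋)
  ... | x , x∈ with x∈p∩q⁻ ⁅ r ⁆ Y x∈
  ...   | x∈r , x∈Y = subst (Sub._∈ Y) (x∈⁅y⁆⇒x≡y r x∈r) x∈Y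

  -- With no point of `R`, the set is neither `edge` nor one of the other edges of the star, so it
  -- is not in the trace and must be large.
  10⇒2≤ : Good s (edge ∷ T) F → ∀ {Y} → Y ⊑ ∁ R → F ∋ (true ∷ false ∷ Y) → 2 ≤ ∣ Y ∣
  10⇒2≤ good Y⊑∁R F∋ with large⊎trace good F∋
  ... | inj₁ (s≤s 2≤) = 2≤
  ... | inj₂ (there X∈T) with sound star X∈T
  ...   | r , r∈R , refl = contradiction r∈R (x∈∁p⇒x∉p (Y⊑∁R (x∈⁅x⁆ r)))

  -- The swap turns `{1} ∪ Y ∪ R` into `{0} ∪ Y`, which has to be large as well, for otherwise the
  -- trace would change.
  NoSmall : Indicator (2 + k) → Set
  NoSmall F = ∀ Y → Y ⊑ ∁ R → F ∋ (false ∷ true ∷ (Y ∪ R)) → 2 ≤ ∣ Y ∣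

  swap-good : 2 ≤ ∣ R ∣ → Good s (edge ∷ T) F → NoSmall F → Good s (edge ∷ T) (F ∘ swap R)
  swap-good {F = F} 2≤∣R∣ good noSmall = record
    { large⊎trace = λ {X} → large⊎trace′ X
    ; trace       = λ {X} → trace′ X
    ; meet        = λ {X} {Y} → meet′ X Y
    ; size        = trans (length-members-∘ F (swap R) (swap R) (swap-involutive R) (swap-involutive R)) (size good)
    }
    where
    large⊎trace′ : ∀ X → (F ∘ swap R) ∋ X → 3 ≤ ∣ X ∣ ⊎ X ∈ edge ∷ T
    large⊎trace′ (true ∷ true ∷ Y) F∋   = large⊎trace good F∋
    large⊎trace′ (false ∷ false ∷ Y) F∋ = large⊎trace good F∋
    large⊎trace′ (true ∷ false ∷ Y) F∋  with Y ⊆? ∁ R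
    ... | yes Y⊑ = inj₁ (s≤s (noSmall Y Y⊑ F∋))
    ... | no  _  = large⊎trace good F∋
    large⊎trace′ (false ∷ true ∷ Y) F∋  with R ⊆? Y
    ... | yes R⊑ = inj₁ (s≤s (≤-trans 2≤∣R∣ (p⊆q⇒∣p∣≤∣q∣ R⊑)))
    ... | no  _  = large⊎trace good F∋

    trace′ : ∀ X → X ∈ edge ∷ T → (F ∘ swap R) ∋ X
    trace′ X (here refl) = trace good (here refl)
    trace′ X (there X∈) with sound star X∈
    -- The edges of the star are not moved by the swap: the leaf `r` is not in `∁ R`.
    ... | r , r∈R , refl
      rewrite dec-false (⁅ r ⁆ ⊆? ∁ R) (λ r⊑ → x∈∁p⇒x∉p (r⊑ (x∈⁅x⁆ r)) r∈R) = trace good (there X∈)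

    meet-10-01 : ∀ Y Z → (F ∘ swap R) ∋ (true ∷ false ∷ Y) → (F ∘ swap R) ∋ (false ∷ true ∷ Z) → Nonempty (Y ∩ Z)
    meet-10-01 Y Z F∋Y F∋Z with R ⊆? Z
    ... | no  R⋢Z = contradiction (λ {x} → 01⇒R⊑ good F∋Z {x}) R⋢Z
    ... | yes R⊑Z with nonempty? (Y ∩ R)
    -- All of `R` lies in `Z`, so a point of `Y` in `R` is already common.
    ...   | yes (x , x∈) = x , x∈p∩q⁺ (p∩q⊆p Y R x∈ , R⊑Z (p∩q⊆q Y R x∈))
    ...   | no  ¬ne with Y ⊆? ∁ R
    ...     | no  Y⋢ = contradiction (λ {x} → disjoint⇒⊑∁ ¬ne {x}) Y⋢
    -- Both sets have changed class: before the swap they were `{1} ∪ Y ∪ R` and `{0} ∪ (Z ∩ ∁ R)`,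
    -- whose common point is outside `R` and hence in `Y`.
    ...     | yes _ with lower-nonempty (meet good F∋Z F∋Y)
    ...       | x , x∈ with x∈p∩q⁻ (Z ∩ ∁ R) (Y ∪ R) x∈
    ...         | x∈Z , x∈Y∪R with x∈p∪q⁻ Y R x∈Y∪R
    ...           | inj₁ x∈Y = x , x∈p∩q⁺ (x∈Y , p∩q⊆p Z (∁ R) x∈Z)
    ...           | inj₂ x∈R = contradiction x∈R (x∈∁p⇒x∉p (p∩q⊆q Z (∁ R) x∈Z))

    meet′ : ∀ X Y → (F ∘ swap R) ∋ X → (F ∘ swap R) ∋ Y → Nonempty (X ∩ Y)
    meet′ X (false ∷ false ∷ Z) F∋X F∋Y = contradiction F∋Y (¬∋00 good)
    meet′ (false ∷ false ∷ Z) Y F∋X F∋Y = contradiction F∋X (¬∋00 good)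
    meet′ (true ∷ _) (true ∷ _) F∋X F∋Y = zero , Vec.here
    meet′ (_ ∷ true ∷ _) (_ ∷ true ∷ _) F∋X F∋Y = suc zero , Vec.there Vec.here
    meet′ (true ∷ false ∷ Y) (false ∷ true ∷ Z) F∋X F∋Y = lift-nonempty (meet-10-01 Y Z F∋X F∋Y)
    meet′ (false ∷ true ∷ Z) (true ∷ false ∷ Y) F∋X F∋Y =
      lift-nonempty (subst Nonempty (∩-comm Y Z) (meet-10-01 Y Z F∋Y F∋X))

two⇒1<∣p∣ : {p : Subset n} {x y : Fin n} → x Sub.∈ p → y Sub.∈ p → ¬ x ≡ y → 1 < ∣ p ∣
two⇒1<∣p∣ {p = p} {x} {y} x∈ y∈ x≢y = subst (_< ∣ p ∣) (∣⁅x⁆∣≡1 x)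
  (p⊂q⇒∣p∣<∣q∣ ((λ z∈ → subst (Sub._∈ p) (sym (x∈⁅y⁆⇒x≡y x z∈)) x∈) , y , y∈ , λ y∈x → x≢y (sym (x∈⁅y⁆⇒x≡y x y∈x))))

-- To gain the full factor `2 ^ ∣ D ∣`, every subset of `D` has to serve as a key for every family,
-- even if a member of the family stands in the way of flipping it.
module StarBound {T : Family (2 + k)} {R : Subset k} (star : Star T R) (pairs : Pairs (edge ∷ T)) (2≤∣R∣ : 2 ≤ ∣ R ∣)
  {x₀ : Fin k} (x₀∉R : ¬ x₀ Sub.∈ R) {D : Subset k} (D⊑∁R : D ⊑ ∁ R) (x₀∉D : ¬ x₀ Sub.∈ D) where

  Blocked : Indicator (2 + k) → Subset k → Set
  Blocked F S = ∃[ Y ] Y ⊑ S × F ∋ (true ∷ false ∷ Y)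

  blocked? : ∀ F S → Dec (Blocked F S)
  blocked? F S = anySubset? λ Y → (Y ⊆? S) ×-dec (F (true ∷ false ∷ Y) Bool.≟ true)

  -- This is exactly what forbids the swap. It also helps: every member `{0} ∪ Y` with `Y` off `R`
  -- has to meet the same set of at most one point, so all these members share that point.
  HasSmall : Indicator (2 + k) → Set
  HasSmall F = ∃[ Y ] Y ⊑ ∁ R × ∣ Y ∣ ≤ 1 × F ∋ (false ∷ true ∷ (Y ∪ R))

  hasSmall? : ∀ F → Dec (HasSmall F)
  hasSmall? F = anySubset? λ Y → (Y ⊆? ∁ R) ×-dec (∣ Y ∣ ≤? 1) ×-dec (F (false ∷ true ∷ (Y ∪ R)) Bool.≟ true)

  ¬hasSmall⇒noSmall : ¬ HasSmall F → NoSmall star F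
  ¬hasSmall⇒noSmall ¬small Y Y⊑ F∋ = ℕP.≰⇒> λ ∣Y∣≤1 → ¬small (Y , Y⊑ , ∣Y∣≤1 , F∋)

  cap : Subset k → Subset k
  cap S = ∁ R ∩ ∁ S

  -- Either S or its complement within ∁ R can be flipped, possibly after a
  -- swap; x₀ ∉ D tells afterwards which of the two it was.
  data Route (F : Indicator (2 + k)) (S : Subset k) : Indicator (2 + k) → Subset k → Set where
    direct       : ¬ Blocked F S → Route F S F S
    complemented : Blocked F S → HasSmall F → Route F S F (cap S)
    swapped      : Blocked F S → ¬ HasSmall F → Route F S (F ∘ swap R) (cap S)

  route : ∀ F S → ∃[ G ] ∃[ S′ ] Route F S G S′
  route F S with blocked? F S
  ... | no ¬blocked = _ , _ , direct ¬blocked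
  ... | yes blocked with hasSmall? F
  ...   | yes small = _ , _ , complemented blocked small
  ...   | no ¬small = _ , _ , swapped blocked ¬small

  image : Indicator (2 + k) → Subset k → Indicator (2 + k)
  image F S with route F S
  ... | G , S′ , _ = G ∘ flip S′

  route-good : ∀ {F G S S′} → Good s (edge ∷ T) F → Route F S G S′ → Good s (edge ∷ T) G
  route-good good (direct _)         = good
  route-good good (complemented _ _) = good
  route-good {F = F} good (swapped _ ¬small) = swap-good star 2≤∣R∣ good (¬hasSmall⇒noSmall {F = F} ¬small)

  -- `R` provides two points of `∁ S`, and `x` is a third.
  3≤∣∁S∣ : ∀ {S x} → S ⊑ ∁ R → ¬ x Sub.∈ R → ¬ x Sub.∈ S → 3 ≤ ∣ ∁ S ∣
  3≤∣∁S∣ S⊑ x∉R x∉S = ≤-trans (s≤s 2≤∣R∣)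
    (p⊂q⇒∣p∣<∣q∣ ((λ r∈R → x∉p⇒x∈∁p λ r∈S → x∈∁p⇒x∉p (S⊑ r∈S) r∈R) , _ , x∉p⇒x∈∁p x∉S , x∉R))

  ¬01 : ∀ {F S Y} → Good s (edge ∷ T) F → S ⊑ ∁ R → Y ⊑ S → ¬ F ∋ (false ∷ true ∷ Y)
  ¬01 good S⊑ Y⊑S F∋ with 0<∣p∣⇒nonempty {p = R} (≤-trans (s≤s z≤n) 2≤∣R∣)
  ... | r , r∈R = x∈∁p⇒x∉p (S⊑ (Y⊑S (01⇒R⊑ star good F∋ r∈R))) r∈R

  -- The third point comes from a blocking set, which is nonempty, off `R` and inside `S`, hence
  -- outside `cap S`.
  cap-size : ∀ {F S} → Good s (edge ∷ T) F → S ∈ subsetsOf D → Blocked F S → 3 ≤ ∣ ∁ (cap S) ∣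
  cap-size {S = S} good S∈ (Y , Y⊑S , F∋) with 0<∣p∣⇒nonempty {p = Y}
    (≤-trans (s≤s z≤n) (10⇒2≤ star good (λ x∈ → D⊑∁R (∈-subsetsOf⁻ D S∈ (Y⊑S x∈))) F∋))
  ... | y , y∈Y = 3≤∣∁S∣ (p∩q⊆p (∁ R) (∁ S)) (x∈∁p⇒x∉p (D⊑∁R (∈-subsetsOf⁻ D S∈ (Y⊑S y∈Y))))
    λ y∈cap → x∈∁p⇒x∉p (p∩q⊆q (∁ R) (∁ S) y∈cap) (Y⊑S y∈Y)

  meet-within : ∀ {F Y Z} → Good s (edge ∷ T) F → Y ⊑ ∁ R → F ∋ (true ∷ false ∷ Y) → F ∋ (false ∷ true ∷ (Z ∪ R)) →
    ∃[ x ] x Sub.∈ Y × x Sub.∈ Z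
  meet-within {Y = Y} {Z} good Y⊑∁R F∋Y F∋Z with lower-nonempty (meet good F∋Y F∋Z)
  ... | x , x∈ with x∈p∩q⁻ Y (Z ∪ R) x∈
  ...   | x∈Y , x∈Z∪R with x∈p∪q⁻ Z R x∈Z∪R
  ...     | inj₁ x∈Z = x , x∈Y , x∈Z
  ...     | inj₂ x∈R = contradiction x∈R (x∈∁p⇒x∉p (Y⊑∁R x∈Y))

  route-flippable : ∀ {F G S S′} → Good s (edge ∷ T) F → S ∈ subsetsOf D → Route F S G S′ → Flippable S′ G
  route-flippable good S∈ (direct ¬blocked) =
    3≤∣∁S∣ (λ x∈ → D⊑∁R (∈-subsetsOf⁻ D S∈ x∈)) x₀∉R (λ x₀∈ → x₀∉D (∈-subsetsOf⁻ D S∈ x₀∈)) ,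
    λ {Y} Y⊑S → (λ F∋ → ¬blocked (Y , Y⊑S , F∋)) , ¬01 good (λ x∈ → D⊑∁R (∈-subsetsOf⁻ D S∈ x∈)) Y⊑S
  -- A member `{0} ∪ Y` with `Y` in `cap S` and the blocking member given by `Y₀` both meet
  -- `{1} ∪ Z ∪ R` inside `Z`. As `Z` has at most one point, `Y` and `Y₀` would share it, but `Y₀`
  -- lies in `S`.
  route-flippable {F = F} {S = S} good S∈ (complemented blocked@(Y₀ , Y₀⊑S , F∋Y₀) (Z , _ , ∣Z∣≤1 , F∋Z)) =
    cap-size good S∈ blocked , λ {Y} Y⊑ → ¬10 Y⊑ , ¬01 good (p∩q⊆p (∁ R) (∁ S)) Y⊑
    where
    ¬10 : ∀ {Y} → Y ⊑ cap S → ¬ F ∋ (true ∷ false ∷ Y)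
    ¬10 Y⊑ F∋Y
      with meet-within good (λ x∈ → D⊑∁R (∈-subsetsOf⁻ D S∈ (Y₀⊑S x∈))) F∋Y₀ F∋Z
         | meet-within good (λ x∈ → p∩q⊆p (∁ R) (∁ S) (Y⊑ x∈)) F∋Y F∋Z
    ... | y , y∈Y₀ , y∈Z | z , z∈Y , z∈Z = ℕP.<⇒≱ (two⇒1<∣p∣ y∈Z z∈Z y≢z) ∣Z∣≤1
      where
      y≢z : ¬ y ≡ z
      y≢z refl = x∈∁p⇒x∉p (p∩q⊆q (∁ R) (∁ S) (Y⊑ z∈Y)) (Y₀⊑S y∈Y₀)
  -- After the swap a set `{0} ∪ Y` with `Y` in `cap S` stands for `{1} ∪ Y ∪ R` before it. That set
  -- would be disjoint from `{0} ∪ Y₀`.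
  route-flippable {F = F} {S = S} good S∈ (swapped blocked@(Y₀ , Y₀⊑S , F∋Y₀) ¬small) =
    cap-size good S∈ blocked ,
    λ {Y} Y⊑ → ¬10 Y⊑ , ¬01 (swap-good star 2≤∣R∣ good (¬hasSmall⇒noSmall {F = F} ¬small)) (p∩q⊆p (∁ R) (∁ S)) Y⊑
    where
    ¬10 : ∀ {Y} → Y ⊑ cap S → ¬ (F ∘ swap R) ∋ (true ∷ false ∷ Y)
    ¬10 {Y} Y⊑ F∋Y with Y ⊆? ∁ R
    ... | no  Y⋢ = Y⋢ (λ x∈ → p∩q⊆p (∁ R) (∁ S) (Y⊑ x∈))
    ... | yes _ with meet-within good (λ x∈ → D⊑∁R (∈-subsetsOf⁻ D S∈ (Y₀⊑S x∈))) F∋Y₀ F∋Y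
    ...   | y , y∈Y₀ , y∈Y = x∈∁p⇒x∉p (p∩q⊆q (∁ R) (∁ S) (Y⊑ y∈Y)) (Y₀⊑S y∈Y₀)

  cap-⊑ : ∀ {S S′} → S ∈ subsetsOf D → cap S ≡ cap S′ → S ⊑ S′
  cap-⊑ {S} {S′} S∈ eq {x} x∈S with x SubP.∈? S′
  ... | yes x∈S′ = x∈S′
  ... | no  x∉S′ = contradiction x∈S (x∈∁p⇒x∉p (p∩q⊆q (∁ R) (∁ S)
    (subst (x Sub.∈_) (sym eq) (x∈p∩q⁺ (D⊑∁R (∈-subsetsOf⁻ D S∈ x∈S) , x∉p⇒x∈∁p x∉S′)))))

  cap-injective : ∀ {S S′} → S ∈ subsetsOf D → S′ ∈ subsetsOf D → cap S ≡ cap S′ → S ≡ S′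
  cap-injective {S} {S′} S∈ S′∈ eq = ⊆-antisym {i = S} {S′} (cap-⊑ S∈ eq) (cap-⊑ S′∈ (sym eq))

  direct≢cap : ∀ {S S′} → S ∈ subsetsOf D → S′ ∈ subsetsOf D → ¬ S ≡ cap S′
  direct≢cap S∈ S′∈ eq = x₀∉D (∈-subsetsOf⁻ D S∈ (subst (x₀ Sub.∈_) (sym eq)
    (x∈p∩q⁺ (x∉p⇒x∈∁p x₀∉R , x∉p⇒x∈∁p λ x₀∈ → x₀∉D (∈-subsetsOf⁻ D S′∈ x₀∈)))))

  -- A small member of a swapped family would come from some `{0} ∪ Z` with at most two points,
  -- against `10⇒2≤`. This keeps the images of `complemented` and `swapped` apart, although both
  -- flip by a set `cap S`.
  swap-no-small : ∀ {F F′} → Good s (edge ∷ T) F′ → HasSmall F → ¬ (∀ X → F X ≡ F′ (swap R X))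
  swap-no-small {F = F} {F′} good′ (Z , Z⊑ , ∣Z∣≤1 , F∋Z) eq =
    ℕP.<⇒≱ (10⇒2≤ star good′ Z⊑ F′∋Z) ∣Z∣≤1
    where
    F′∋Z : F′ ∋ (true ∷ false ∷ Z)
    F′∋Z = subst (λ X → F′ X ≡ true) (cong (λ X → true ∷ false ∷ X) (∪-∩∁ Z⊑)) F′∋swap
      where
      F′∋swap : F′ ∋ (true ∷ false ∷ ((Z ∪ R) ∩ ∁ R))
      F′∋swap = subst (λ b → F′ (if b then true ∷ false ∷ ((Z ∪ R) ∩ ∁ R) else false ∷ true ∷ (Z ∪ R)) ≡ true)
        (dec-true (R ⊆? (Z ∪ R)) (λ x∈ → x∈p∪q⁺ (inj₂ x∈))) (trans (sym (eq (false ∷ true ∷ (Z ∪ R)))) F∋Z)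

  route-injective : ∀ {F F′ G G′ S S′ P P′} → Good s (edge ∷ T) F → Good s (edge ∷ T) F′ →
    S ∈ subsetsOf D → S′ ∈ subsetsOf D → Route F S G P → Route F′ S′ G′ P′ →
    P ≡ P′ → (∀ X → G X ≡ G′ X) → S ≡ S′ × (∀ X → F X ≡ F′ X)
  route-injective _ _ S∈ S′∈ (direct _) (direct _) P≡ G≗ = P≡ , G≗
  route-injective _ _ S∈ S′∈ (direct _) (complemented _ _) P≡ G≗ = contradiction P≡ (direct≢cap S∈ S′∈)
  route-injective _ _ S∈ S′∈ (direct _) (swapped _ _) P≡ G≗ = contradiction P≡ (direct≢cap S∈ S′∈)
  route-injective _ _ S∈ S′∈ (complemented _ _) (direct _) P≡ G≗ = contradiction (sym P≡) (direct≢cap S′∈ S∈)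
  route-injective _ _ S∈ S′∈ (swapped _ _) (direct _) P≡ G≗ = contradiction (sym P≡) (direct≢cap S′∈ S∈)
  route-injective _ _ S∈ S′∈ (complemented _ _) (complemented _ _) P≡ G≗ = cap-injective S∈ S′∈ P≡ , G≗
  route-injective {F = F} {F′} _ _ S∈ S′∈ (swapped _ _) (swapped _ _) P≡ G≗ = cap-injective S∈ S′∈ P≡ ,
    λ X → trans (cong F (sym (swap-involutive R X))) (trans (G≗ (swap R X)) (cong F′ (swap-involutive R X)))
  route-injective _ good′ S∈ S′∈ (complemented _ small) (swapped _ _) P≡ G≗ = contradiction G≗ (swap-no-small good′ small)
  route-injective good _ S∈ S′∈ (swapped _ _) (complemented _ small) P≡ G≗ = contradiction (sym ∘ G≗) (swap-no-small good small)

  star-bound : #extensions s (edge ∷ T) * 2 ^ ∣ D ∣ ≤ #extensions s T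
  star-bound {s} = subst (λ l → #extensions s (edge ∷ T) * l ≤ #extensions s T) (length-subsetsOf D)
    (#extensions-injection pairs (tail-pairs pairs) (subsetsOf-unique D) image image-good image-injective)
    where
    tail-pairs : Pairs (edge ∷ T) → Pairs T
    tail-pairs ((_ ∷ u) , (_ ∷ two)) = u , two
    image-good : ∀ {F S} → Good s (edge ∷ T) F → S ∈ subsetsOf D → Good s T (image F S)
    image-good {F} {S} good S∈ with route F S
    ... | _ , _ , ρ = flip-good pairs (route-good good ρ) (route-flippable good S∈ ρ)
    image-injective : ∀ {F F′ S S′} → Good s (edge ∷ T) F → Good s (edge ∷ T) F′ → S ∈ subsetsOf D → S′ ∈ subsetsOf D →
      (∀ X → image F S X ≡ image F′ S′ X) → S ≡ S′ × (∀ X → F X ≡ F′ X)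
    image-injective {F} {F′} {S} {S′} good good′ S∈ S′∈ eq with route F S | route F′ S′
    ... | _ , _ , ρ | _ , _ , ρ′ with flip-injective (route-good good ρ) (route-good good′ ρ′) eq
    ...   | P≡ , G≗ = route-injective good good′ S∈ S′∈ ρ ρ′ P≡ G≗

-- Moving stars and triangles into standard position

∣p∣≡1⇒singleton : {p : Subset n} → ∣ p ∣ ≡ 1 → ∃[ x ] p ≡ ⁅ x ⁆
∣p∣≡1⇒singleton {p = true ∷ p}  ∣p∣≡1 = zero , cong (true ∷_) (∣p∣≡0⇒p≡⊥ (ℕP.suc-injective ∣p∣≡1))
∣p∣≡1⇒singleton {p = false ∷ p} ∣p∣≡1 with ∣p∣≡1⇒singleton {p = p} ∣p∣≡1
... | x , refl = suc x , refl

∣⁅x⁆∪p∣ : {p : Subset n} {x : Fin n} → ¬ x Sub.∈ p → ∣ ⁅ x ⁆ ∪ p ∣ ≡ suc ∣ p ∣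
∣⁅x⁆∪p∣ {p = true ∷ p}  {zero}  x∉p = contradiction Vec.here x∉p
∣⁅x⁆∪p∣ {p = false ∷ p} {zero}  x∉p = cong (λ q → suc ∣ q ∣) (SubP.∪-identityˡ p)
∣⁅x⁆∪p∣ {p = true ∷ p}  {suc x} x∉p = cong suc (∣⁅x⁆∪p∣ {p = p} λ x∈ → x∉p (Vec.there x∈))
∣⁅x⁆∪p∣ {p = false ∷ p} {suc x} x∉p = ∣⁅x⁆∪p∣ {p = p} λ x∈ → x∉p (Vec.there x∈)

subset-of-size : {P : Subset n} {d : ℕ} → d ≤ ∣ P ∣ → ∃[ D ] D ⊑ P × ∣ D ∣ ≡ d
subset-of-size {n} {d = zero} _ = ⊥ , ⊥⊆ , SubP.∣⊥∣≡0 n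
subset-of-size {P = false ∷ P} {suc d} d≤ with subset-of-size {P = P} d≤
... | D , D⊑ , ∣D∣ = false ∷ D , SubP.s⊆s D⊑ , ∣D∣
subset-of-size {P = true ∷ P} {suc d} (s≤s d≤) with subset-of-size {P = P} d≤
... | D , D⊑ , ∣D∣ = true ∷ D , SubP.s⊆s D⊑ , cong suc ∣D∣

subset-avoiding : {P : Subset n} {d : ℕ} → d < ∣ P ∣ → ∃[ x ] ∃[ D ] x Sub.∈ P × D ⊑ P × ¬ x Sub.∈ D × ∣ D ∣ ≡ d
subset-avoiding {P = true ∷ P} (s≤s d≤) with subset-of-size {P = P} d≤
... | D , D⊑ , ∣D∣ = zero , false ∷ D , Vec.here , SubP.out⊆ D⊑ , (λ ()) , ∣D∣
subset-avoiding {P = false ∷ P} d< with subset-avoiding {P = P} d<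
... | x , D , x∈ , D⊑ , x∉ , ∣D∣ = suc x , false ∷ D , Vec.there x∈ , SubP.s⊆s D⊑ , (λ { (Vec.there x∈D) → x∉ x∈D }) , ∣D∣

x∉p⇒lookup : {p : Subset n} {x : Fin n} → ¬ x Sub.∈ p → lookup p x ≡ false
x∉p⇒lookup {p = p} {x} x∉p with lookup p x in eq
... | true  = contradiction (VecP.lookup⇒[]= x p eq) x∉p
... | false = refl

∈⇒∣removeAt∣ : {X : Subset (suc n)} {v : Fin (suc n)} → v Sub.∈ X → ∣ X ∣ ≡ suc ∣ removeAt X v ∣
∈⇒∣removeAt∣ {X = X} {v} v∈X = trans (sym (∣lookup∷removeAt∣ X v)) (cong (λ b → ∣ b ∷ removeAt X v ∣) (VecP.[]=⇒lookup v∈X))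

-- The point `v`, the intended centre, becomes the first coordinate, so that membership of `v` is
-- visible in the head of the transformed vector.
record Normalised (X : Subset (2 + k)) (v : Fin (2 + k)) : Set where
  field
    symmetry : Symmetry (2 + k)
    to-edge  : to symmetry X ≡ edge
    to-∈     : ∀ {Y} → v Sub.∈ Y → ∃[ Z ] to symmetry Y ≡ true ∷ Z
    to-∉     : ∀ {Y} → ¬ v Sub.∈ Y → ∃[ Z ] to symmetry Y ≡ false ∷ Z

open Normalised

normalise : {X : Subset (2 + k)} → ∣ X ∣ ≡ 2 → ∀ {v} → v Sub.∈ X → Normalised X v
normalise {k} {X} ∣X∣≡2 {v} v∈X = record
  { symmetry = σ ; to-edge = σX≡
  ; to-∈ = λ v∈ → _ , cong₂ _∷_ (VecP.[]=⇒lookup v∈) refl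
  ; to-∉ = λ v∉ → _ , cong₂ _∷_ (x∉p⇒lookup v∉) refl }
  where
  ∣X-v∣≡1 : ∣ removeAt X v ∣ ≡ 1
  ∣X-v∣≡1 = ℕP.suc-injective (trans (sym (∈⇒∣removeAt∣ v∈X)) ∣X∣≡2)
  other = 0<∣p∣⇒nonempty {p = removeAt X v} (subst (0 <_) (sym ∣X-v∣≡1) (s≤s z≤n))
  w = proj₁ other
  σ = bringToFront v then under (bringToFront w)
  σX≡ : to σ X ≡ edge
  σX≡ = cong₂ _∷_ (VecP.[]=⇒lookup v∈X) (cong₂ _∷_ (VecP.[]=⇒lookup (proj₂ other))
    (∣p∣≡0⇒p≡⊥ (ℕP.suc-injective (trans (sym (∈⇒∣removeAt∣ (proj₂ other))) ∣X-v∣≡1))))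

pairs-tail : {X : Subset n} {T : Family n} → Pairs (X ∷ T) → Pairs T
pairs-tail ((_ ∷ u) , (_ ∷ two)) = u , two

good⇒2≤ : {T : Family n} → Pairs T → Good s T F → ∀ {X} → F ∋ X → 2 ≤ ∣ X ∣
good⇒2≤ (_ , two) good F∋ with large⊎trace good F∋
... | inj₁ 3≤ = ≤-trans (s≤s (s≤s z≤n)) 3≤
... | inj₂ X∈ = ≤-reflexive (sym (All.lookup two X∈))

pair-nonempty : {X : Subset n} → ∣ X ∣ ≡ 2 → Nonempty X
pair-nonempty {X = X} ∣X∣≡2 = 0<∣p∣⇒nonempty (subst (0 <_) (sym ∣X∣≡2) (s≤s z≤n))

#extensions-∷-normalised : {X : Subset (2 + k)} {T : Family (2 + k)} {v : Fin (2 + k)} (N : Normalised X v) →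
  Pairs (X ∷ T) → #extensions s (edge ∷ map (to (symmetry N)) T) ≡ #extensions s (X ∷ T)
#extensions-∷-normalised {s = s} {T = T} N pairs =
  trans (cong (λ Y → #extensions s (Y ∷ map (to (symmetry N)) T)) (sym (to-edge N))) (#extensions-map (symmetry N) pairs)

pairs-normalised : {X : Subset (2 + k)} {T : Family (2 + k)} {v : Fin (2 + k)} (N : Normalised X v) →
  Pairs (X ∷ T) → Pairs (edge ∷ map (to (symmetry N)) T)
pairs-normalised {T = T} N pairs = subst (λ Y → Pairs (Y ∷ map (to (symmetry N)) T)) (to-edge N) (map-pairs (symmetry N) pairs)

-- The only key is `S = ⊥`, so the edge alone is replaced by its complement. A member that could
-- block this would be a singleton, and there is none.
#extensions-∷-≤ : 3 ≤ k → {X : Subset (2 + k)} {T : Family (2 + k)} → Pairs (X ∷ T) → #extensions s (X ∷ T) ≤ #extensions s T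
#extensions-∷-≤ {k} {s} 3≤k {X} {T} pairs@(_ , (∣X∣≡2 ∷ _)) = begin
  #extensions s (X ∷ T)          ≡⟨ #extensions-∷-normalised N pairs ⟨
  #extensions s (edge ∷ T′)      ≡⟨ *-identityʳ _ ⟨
  #extensions s (edge ∷ T′) * 1  ≤⟨ flip-bound pairs′ {Ss = [ ⊥ ]} ([] ∷ [])
                                      (λ { good (here refl) → 3≤∣∁⊥∣ , λ Y⊑ → small good Y⊑ }) ⟩
  #extensions s T′               ≡⟨ #extensions-map (symmetry N) (pairs-tail pairs) ⟩
  #extensions s T                ∎
  where
  open ℕP.≤-Reasoning
  N = normalise ∣X∣≡2 (proj₂ (pair-nonempty ∣X∣≡2))
  T′ = map (to (symmetry N)) T
  pairs′ = pairs-normalised N pairs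
  3≤∣∁⊥∣ : 3 ≤ ∣ ∁ (⊥ {k}) ∣
  3≤∣∁⊥∣ = subst (3 ≤_) (sym (trans (SubP.∣∁p∣≡n∸∣p∣ (⊥ {k})) (cong (k ∸_) (SubP.∣⊥∣≡0 k)))) 3≤k
  too-small : ∀ {Y : Subset k} → Y ⊑ ⊥ → ¬ 2 ≤ suc ∣ Y ∣
  too-small Y⊑⊥ (s≤s 1≤) = ℕP.<⇒≱ (≤-trans 1≤ (p⊆q⇒∣p∣≤∣q∣ Y⊑⊥)) (≤-reflexive (SubP.∣⊥∣≡0 k))
  small : ∀ {F} → Good s (edge ∷ T′) F → ∀ {Y} → Y ⊑ ⊥ → ¬ F ∋ (true ∷ false ∷ Y) × ¬ F ∋ (false ∷ true ∷ Y)
  small good Y⊑⊥ = (λ F∋ → too-small Y⊑⊥ (good⇒2≤ pairs′ good F∋)) , (λ F∋ → too-small Y⊑⊥ (good⇒2≤ pairs′ good F∋))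

Ray : Subset (2 + k) → Set
Ray X = ∃[ r ] X ≡ true ∷ false ∷ ⁅ r ⁆

rays⇒star : {T : Family (2 + k)} → Unique T → All Ray T → ∃[ R ] Star T R × ∣ R ∣ ≡ length T
rays⇒star {k} [] [] = ⊥ , record { sound = λ () ; complete = λ r∈ → contradiction r∈ ∉⊥ } , SubP.∣⊥∣≡0 k
rays⇒star {T = X ∷ T} (X∉ ∷ u) ((r , refl) ∷ rays) with rays⇒star u rays
... | R , star , ∣R∣ = ⁅ r ⁆ ∪ R , record { sound = sound′ ; complete = complete′ } ,
  trans (∣⁅x⁆∪p∣ (λ r∈R → All¬⇒¬Any X∉ (complete star r∈R))) (cong suc ∣R∣)
  where
  sound′ : ∀ {Y} → Y ∈ (true ∷ false ∷ ⁅ r ⁆) ∷ T → ∃[ q ] q Sub.∈ ⁅ r ⁆ ∪ R × Y ≡ true ∷ false ∷ ⁅ q ⁆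
  sound′ (here refl) = r , x∈p∪q⁺ (inj₁ (x∈⁅x⁆ r)) , refl
  sound′ (there Y∈) with sound star Y∈
  ... | q , q∈R , Y≡ = q , x∈p∪q⁺ (inj₂ q∈R) , Y≡
  complete′ : ∀ {q} → q Sub.∈ ⁅ r ⁆ ∪ R → true ∷ false ∷ ⁅ q ⁆ ∈ (true ∷ false ∷ ⁅ r ⁆) ∷ T
  complete′ q∈ with x∈p∪q⁻ ⁅ r ⁆ R q∈
  ... | inj₁ q∈r = here (cong (λ q → true ∷ false ∷ ⁅ q ⁆) (x∈⁅y⁆⇒x≡y r q∈r))
  ... | inj₂ q∈R = there (complete star q∈R)

ray : {X : Subset (2 + k)} → ∣ X ∣ ≡ 2 → ∃[ Z ] X ≡ true ∷ Z → ¬ X ≡ edge → Ray X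
ray ∣X∣≡2 (true ∷ Z , refl)  X≢ = contradiction
  (cong (λ Z → true ∷ true ∷ Z) (∣p∣≡0⇒p≡⊥ (ℕP.suc-injective (ℕP.suc-injective ∣X∣≡2)))) X≢
ray ∣X∣≡2 (false ∷ Z , refl) X≢ with ∣p∣≡1⇒singleton {p = Z} (ℕP.suc-injective ∣X∣≡2)
... | r , refl = r , refl

pairs-∉ : {X : Subset n} {T : Family n} → Pairs (X ∷ T) → ∀ {Y} → Y ∈ T → ¬ Y ≡ X
pairs-∉ ((X∉ ∷ _) , _) Y∈ refl = All¬⇒¬Any X∉ Y∈

-- Off the edge there are `k` points. The other leaves take `length T` of them and `x₀` takes one;
-- the strict inequality leaves `d` for `D`.
#extensions-star : ∀ {d} {X : Subset (2 + k)} {T : Family (2 + k)} {v} → Pairs (X ∷ T) → v Sub.∈ X → All (v Sub.∈_) T →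
  2 ≤ length T → d + length T < k → #extensions s (X ∷ T) * 2 ^ d ≤ #extensions s T
#extensions-star {k} {s} {d} {X} {T} {v} pairs@(_ , (∣X∣≡2 ∷ _)) v∈X v∈T 2≤ d< = begin
  #extensions s (X ∷ T) * 2 ^ d      ≡⟨ cong₂ (λ a b → a * 2 ^ b) (#extensions-∷-normalised N pairs) ∣D∣ ⟨
  #extensions s (edge ∷ T′) * 2 ^ ∣ D ∣  ≤⟨ StarBound.star-bound star pairs′ 2≤∣R∣ (x∈∁p⇒x∉p x₀∈) D⊑ x₀∉D ⟩
  #extensions s T′                   ≡⟨ #extensions-map (symmetry N) (pairs-tail pairs) ⟩
  #extensions s T                    ∎
  where
  open ℕP.≤-Reasoning
  N = normalise ∣X∣≡2 v∈X
  T′ = map (to (symmetry N)) T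
  pairs′ = pairs-normalised N pairs
  rays : ∀ {Y} → Y ∈ T′ → Ray Y
  rays Y∈ with ∈-map⁻ (to (symmetry N)) Y∈
  ... | Z , Z∈ , refl = ray (All.lookup (proj₂ (pairs-tail pairs′)) Y∈) (to-∈ N (All.lookup v∈T Z∈)) (pairs-∉ pairs′ Y∈)
  starR = rays⇒star (proj₁ (pairs-tail pairs′)) (All.tabulate rays)
  R = proj₁ starR
  star = proj₁ (proj₂ starR)
  ∣R∣≡ : ∣ R ∣ ≡ length T
  ∣R∣≡ = trans (proj₂ (proj₂ starR)) (length-map (to (symmetry N)) T)
  2≤∣R∣ : 2 ≤ ∣ R ∣
  2≤∣R∣ = subst (2 ≤_) (sym ∣R∣≡) 2≤
  d<∣∁R∣ : d < ∣ ∁ R ∣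
  d<∣∁R∣ = subst (d <_) (sym (trans (SubP.∣∁p∣≡n∸∣p∣ R) (cong (k ∸_) ∣R∣≡))) (ℕP.m+n≤o⇒m≤o∸n (suc d) d<)
  chosen = subset-avoiding {P = ∁ R} d<∣∁R∣
  D = proj₁ (proj₂ chosen)
  x₀∈ = proj₁ (proj₂ (proj₂ chosen))
  D⊑ : D ⊑ ∁ R
  D⊑ = proj₁ (proj₂ (proj₂ (proj₂ chosen)))
  x₀∉D = proj₁ (proj₂ (proj₂ (proj₂ (proj₂ chosen))))
  ∣D∣ = proj₂ (proj₂ (proj₂ (proj₂ (proj₂ chosen))))

-- A member with exactly one end of the edge has to meet the opposite side of the triangle, hence
-- contains the apex `r`. Keys avoid `r`, so all of them can be flipped directly, and `3 + d ≤ k`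
-- only serves to keep the complements large.
normal-triangle : ∀ {d} {r : Fin k} → Pairs (edge ∷ (true ∷ false ∷ ⁅ r ⁆) ∷ (false ∷ true ∷ ⁅ r ⁆) ∷ []) → 3 + d ≤ k →
  #extensions s (edge ∷ (true ∷ false ∷ ⁅ r ⁆) ∷ (false ∷ true ∷ ⁅ r ⁆) ∷ []) * 2 ^ d ≤
  #extensions s ((true ∷ false ∷ ⁅ r ⁆) ∷ (false ∷ true ∷ ⁅ r ⁆) ∷ [])
normal-triangle {k} {s} {d} {r} pairs 3+d≤k = begin
  #extensions s (edge ∷ T) * 2 ^ d                ≡⟨ cong (λ b → #extensions s (edge ∷ T) * 2 ^ b) ∣D∣ ⟨
  #extensions s (edge ∷ T) * 2 ^ ∣ D ∣            ≡⟨ cong (#extensions s (edge ∷ T) *_) (length-subsetsOf D) ⟨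
  #extensions s (edge ∷ T) * length (subsetsOf D) ≤⟨ flip-bound pairs (subsetsOf-unique D) flippable ⟩
  #extensions s T                                 ∎
  where
  open ℕP.≤-Reasoning
  T = (true ∷ false ∷ ⁅ r ⁆) ∷ (false ∷ true ∷ ⁅ r ⁆) ∷ []
  ∣∁_∣ : (p : Subset k) → ∣ ∁ p ∣ ≡ k ∸ ∣ p ∣
  ∣∁ p ∣ = SubP.∣∁p∣≡n∸∣p∣ p
  chosen = subset-of-size {P = ∁ ⁅ r ⁆} {d} (subst (d ≤_) (sym (trans ∣∁ ⁅ r ⁆ ∣ (cong (k ∸_) (∣⁅x⁆∣≡1 r))))
    (ℕP.m+n≤o⇒m≤o∸n d (≤-trans (≤-trans (≤-reflexive (ℕP.+-comm d 1)) (m≤n+m (1 + d) 2)) 3+d≤k)))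
  D = proj₁ chosen
  D⊑ : D ⊑ ∁ ⁅ r ⁆
  D⊑ = proj₁ (proj₂ chosen)
  ∣D∣ = proj₂ (proj₂ chosen)
  avoids : ∀ {S Y} → S ∈ subsetsOf D → Y ⊑ S → ¬ Nonempty (⁅ r ⁆ ∩ Y)
  avoids {Y = Y} S∈ Y⊑S (x , x∈) with x∈p∩q⁻ ⁅ r ⁆ Y x∈
  ... | x∈r , x∈Y = x∈∁p⇒x∉p (D⊑ (∈-subsetsOf⁻ D S∈ (Y⊑S x∈Y))) x∈r
  flippable : ∀ {F S} → Good s (edge ∷ T) F → S ∈ subsetsOf D → Flippable S F
  flippable {S = S} good S∈ =
    subst (3 ≤_) (sym ∣∁ S ∣) (ℕP.m+n≤o⇒m≤o∸n 3
      (≤-trans (+-monoʳ-≤ 3 (≤-trans (p⊆q⇒∣p∣≤∣q∣ (∈-subsetsOf⁻ D S∈)) (≤-reflexive ∣D∣))) 3+d≤k)) ,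
    λ {Y} Y⊑S → (λ F∋ → avoids {Y = Y} S∈ Y⊑S (lower-nonempty (meet good (trace good (there (there (here refl)))) F∋))) ,
                (λ F∋ → avoids {Y = Y} S∈ Y⊑S (lower-nonempty (meet good (trace good (there (here refl))) F∋)))

#extensions-triangle : ∀ {d} {X Y Z : Subset (2 + k)} {v} → Pairs (X ∷ Y ∷ Z ∷ []) → v Sub.∈ X → v Sub.∈ Y → ¬ v Sub.∈ Z →
  Nonempty (X ∩ Z) → Nonempty (Y ∩ Z) → 3 + d ≤ k → #extensions s (X ∷ Y ∷ Z ∷ []) * 2 ^ d ≤ #extensions s (Y ∷ Z ∷ [])
#extensions-triangle {k} {s} {d} {X} {Y} {Z} pairs@(_ , (∣X∣≡2 ∷ _)) v∈X v∈Y v∉Z X∩Z Y∩Z 3+d≤k =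
  subst₂ _≤_ (cong (_* 2 ^ d) (#extensions-∷-normalised N pairs)) (#extensions-map (symmetry N) (pairs-tail pairs)) bound
  where
  N = normalise ∣X∣≡2 v∈X
  τ = to (symmetry N)
  pairs′ = pairs-normalised N pairs
  two′ = proj₂ pairs′
  rayY : Ray (τ Y)
  rayY = ray (All.lookup two′ (there (here refl))) (to-∈ N v∈Y) (pairs-∉ pairs′ (here refl))
  rayZ : ∀ {W} → ∣ W ∣ ≡ 2 → ∃[ V ] W ≡ false ∷ V → Nonempty (edge ∩ W) → ∃[ q ] W ≡ false ∷ true ∷ ⁅ q ⁆
  rayZ ∣W∣≡2 (true ∷ V , refl) _ with ∣p∣≡1⇒singleton {p = V} (ℕP.suc-injective ∣W∣≡2)
  ... | q , refl = q , refl
  rayZ ∣W∣≡2 (false ∷ V , refl) ne with lower-nonempty ne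
  ... | x , x∈ = contradiction (proj₁ (x∈p∩q⁻ ⊥ V x∈)) ∉⊥
  common : ∀ {A B : Subset (2 + k)} → Pairs (edge ∷ A ∷ B ∷ []) → Ray A → ∃[ q ] B ≡ false ∷ true ∷ ⁅ q ⁆ → Nonempty (A ∩ B) →
    #extensions s (edge ∷ A ∷ B ∷ []) * 2 ^ d ≤ #extensions s (A ∷ B ∷ [])
  common pairs (r , refl) (q , refl) ne with lower-nonempty ne
  ... | x , x∈ with x∈p∩q⁻ ⁅ r ⁆ ⁅ q ⁆ x∈
  ...   | x∈r , x∈q with x∈⁅y⁆⇒x≡y r x∈r | x∈⁅y⁆⇒x≡y q x∈q
  ...     | refl | refl = normal-triangle pairs 3+d≤k
  bound = common pairs′ rayY
    (rayZ (All.lookup two′ (there (there (here refl)))) (to-∉ N v∉Z)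
      (subst (λ E → Nonempty (E ∩ τ Z)) (to-edge N) (to-meet (symmetry N) X∩Z)))
    (to-meet (symmetry N) Y∩Z)

-- The contribution of traces with one or two members

#extensions-single : {X : Subset (2 + k)} → ∣ X ∣ ≡ 2 → #extensions s [ X ] ≡ #extensions s [ edge {k} ]
#extensions-single {k} {s} {X} ∣X∣≡2 = sym (#extensions-∷-normalised {s = s} {X = X} {T = []}
  (normalise ∣X∣≡2 (proj₂ (pair-nonempty ∣X∣≡2))) (([] ∷ []) , (∣X∣≡2 ∷ [])))

edge′ : Subset (3 + k)
edge′ = true ∷ false ∷ true ∷ ⊥

#extensions-pair : {X Y : Subset (3 + k)} → Pairs (X ∷ Y ∷ []) → Nonempty (X ∩ Y) →
  #extensions s (X ∷ Y ∷ []) ≡ #extensions s (edge ∷ edge′ {k} ∷ [])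
#extensions-pair {k} {s} {X} {Y} pairs@(_ , (∣X∣≡2 ∷ _)) (v , v∈) with x∈p∩q⁻ X Y v∈
... | v∈X , v∈Y = trans (sym (#extensions-∷-normalised N pairs)) (move pairs′ rayY)
  where
  N = normalise ∣X∣≡2 v∈X
  pairs′ = pairs-normalised N pairs
  rayY : Ray (to (symmetry N) Y)
  rayY = ray (All.lookup (proj₂ pairs′) (there (here refl))) (to-∈ N v∈Y) (pairs-∉ pairs′ (here refl))
  move : ∀ {A} → Pairs (edge ∷ A ∷ []) → Ray A → #extensions s (edge ∷ A ∷ []) ≡ #extensions s (edge ∷ edge′ {k} ∷ [])
  move pairs (r , refl) = trans (sym (#extensions-map σ pairs)) (cong₂ (λ A B → #extensions s (A ∷ B ∷ [])) edge↦ ray↦)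
    where
    -- This fixes the first two coordinates, hence the edge, and moves the remaining leaf next to
    -- them.
    σ = under (under (bringToFront r))
    edge↦ : to σ edge ≡ edge
    edge↦ = cong (λ Z → true ∷ true ∷ Z) (∣p∣≡0⇒p≡⊥ (trans (∣to∣ (bringToFront r) ⊥) (SubP.∣⊥∣≡0 (suc k))))
    ray↦ : to σ (true ∷ false ∷ ⁅ r ⁆) ≡ edge′
    ray↦ = cong₂ (λ b Z → true ∷ false ∷ b ∷ Z) (VecP.[]=⇒lookup (x∈⁅x⁆ r))
      (∣p∣≡0⇒p≡⊥ (ℕP.suc-injective (trans (sym (∈⇒∣removeAt∣ (x∈⁅x⁆ r))) (∣⁅x⁆∣≡1 r))))

-- The intersecting family of all sets meeting {0,1,2} in at least two points,
-- with {1,2} replaced by its complement.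
data Maximal : Subset (3 + k) → Set where
  with₀    : ∀ {b c} {Z : Subset k} → b ≡ true ⊎ c ≡ true ⊎ Z ≡ Sub.⊤ → Maximal (true ∷ b ∷ c ∷ Z)
  without₀ : {Z : Subset k} → Nonempty Z → Maximal (false ∷ true ∷ true ∷ Z)

maximal-mixed : ∀ {b c} {Z W : Subset k} → b ≡ true ⊎ c ≡ true ⊎ Z ≡ Sub.⊤ → Nonempty W →
  Nonempty ((true ∷ b ∷ c ∷ Z) ∩ (false ∷ true ∷ true ∷ W))
maximal-mixed (inj₁ refl)        _        = suc zero , Vec.there Vec.here
maximal-mixed (inj₂ (inj₁ refl)) _        = suc (suc zero) , Vec.there (Vec.there Vec.here)
maximal-mixed (inj₂ (inj₂ refl)) (z , z∈) = suc (suc (suc z)) , Vec.there (Vec.there (Vec.there (x∈p∩q⁺ (SubP.∈⊤ , z∈))))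

maximal-meet : {X Y : Subset (3 + k)} → Maximal X → Maximal Y → Nonempty (X ∩ Y)
maximal-meet (with₀ _)    (with₀ _)    = zero , Vec.here
maximal-meet (without₀ _) (without₀ _) = suc zero , Vec.there Vec.here
maximal-meet (with₀ p)    (without₀ ne) = maximal-mixed p ne
maximal-meet {X = X} {Y} (without₀ ne) (with₀ p) = subst Nonempty (∩-comm Y X) (maximal-mixed p ne)

nonempties : ∀ k → List (Subset k)
nonempties k = filter nonempty? (allSubsets k)

length-nonempties : ∀ k → suc (length (nonempties k)) ≡ 2 ^ k
length-nonempties k = trans (↭-length (unique⇒↭ (¬Any⇒All¬ _ ⊥∉ ∷ Uniq.filter⁺ nonempty? (allSubsets-unique k))
  (allSubsets-unique k) (λ {X} _ → ∈-allSubsets X) (λ {X} _ → onto X))) (length-allSubsets k)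
  where
  ⊥∉ : ¬ ⊥ ∈ nonempties k
  ⊥∉ ⊥∈ = ∉⊥ (proj₂ (proj₂ (∈-filter⁻ nonempty? {xs = allSubsets k} ⊥∈)))
  onto : ∀ X → X ∈ ⊥ ∷ nonempties k
  onto X with nonempty? X
  ... | yes ne = there (∈-filter⁺ nonempty? (∈-allSubsets X) ne)
  ... | no ¬ne = here (SubP.Empty-unique ¬ne)

blocks-with₀ : ∀ k → List (Subset (2 + k))
blocks-with₀ k = join (join (allSubsets k) (nonempties k)) (join (nonempties k) [ Sub.⊤ ])

-- These are the sets in `Maximal` other than `edge` and `edge′`: taking `nonempties` instead of
-- `allSubsets` in two of the blocks drops precisely these two.
blocks : ∀ k → List (Subset (3 + k))
blocks k = join (blocks-with₀ k) (join (join (nonempties k) []) [])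

length-blocks : ∀ k → 2 + length (blocks k) ≡ 2 ^ (2 + k)
length-blocks k = begin
  2 + length (blocks k)
    ≡⟨ cong (2 +_) (trans (length-join (join (join U N) (join N [ Sub.⊤ ])) (join (join N []) [])) (cong₂ _+_
         (trans (length-join (join U N) (join N [ Sub.⊤ ])) (cong₂ _+_ (length-join U N) (length-join N [ Sub.⊤ ])))
         (trans (length-join (join N []) []) (cong (_+ 0) (length-join N []))))) ⟩
  2 + ((length U + length N) + (length N + 1) + (length N + 0 + 0))
    ≡⟨ cong (λ u → 2 + ((u + length N) + (length N + 1) + (length N + 0 + 0)))
         (trans (length-allSubsets k) (sym (length-nonempties k))) ⟩
  2 + ((suc (length N) + length N) + (length N + 1) + (length N + 0 + 0))
    ≡⟨ arithmetic (length N) ⟩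
  2 * (2 * suc (length N))
    ≡⟨ cong (λ m → 2 * (2 * m)) (length-nonempties k) ⟩
  2 ^ (2 + k) ∎
  where
  open ≡-Reasoning
  U = allSubsets k
  N = nonempties k
  arithmetic : ∀ m → 2 + ((suc m + m) + (m + 1) + (m + 0 + 0)) ≡ 2 * (2 * suc m)
  arithmetic = solve-∀

nonempties-unique : ∀ k → Unique (nonempties k)
nonempties-unique k = Uniq.filter⁺ nonempty? (allSubsets-unique k)

blocks-unique : ∀ k → Unique (blocks k)
blocks-unique k = join-unique
  (join-unique (join-unique (allSubsets-unique k) (nonempties-unique k)) (join-unique (nonempties-unique k) ([] ∷ [])))
  (join-unique (join-unique (nonempties-unique k) []) [])

∈-nonempties⁻ : {Z : Subset k} → Z ∈ nonempties k → Nonempty Z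
∈-nonempties⁻ {k} Z∈ = proj₂ (∈-filter⁻ nonempty? {xs = allSubsets k} Z∈)

blocks-maximal : ∀ {X} → 2 ≤ k → X ∈ blocks k → Maximal X × 3 ≤ ∣ X ∣
blocks-maximal {k} {true ∷ true ∷ true ∷ Z} _ X∈ = with₀ (inj₁ refl) , s≤s (s≤s (s≤s z≤n))
blocks-maximal {k} {true ∷ true ∷ false ∷ Z} _ X∈ = with₀ (inj₁ refl) ,
  s≤s (s≤s (nonempty⇒0<∣p∣ (∈-nonempties⁻ (∈-join-false⁻ {𝓧 = allSubsets k} (∈-join-true⁻ (∈-join-true⁻ X∈))))))
blocks-maximal {k} {true ∷ false ∷ true ∷ Z} _ X∈ = with₀ (inj₂ (inj₁ refl)) ,
  s≤s (s≤s (nonempty⇒0<∣p∣ (∈-nonempties⁻ (∈-join-true⁻ (∈-join-false⁻ {𝓧 = join (allSubsets k) (nonempties k)} (∈-join-true⁻ X∈))))))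
blocks-maximal {k} {true ∷ false ∷ false ∷ Z} 2≤k X∈
  with ∈-join-false⁻ {𝓧 = nonempties k} (∈-join-false⁻ {𝓧 = join (allSubsets k) (nonempties k)} (∈-join-true⁻ X∈))
... | here refl = with₀ (inj₂ (inj₂ refl)) , s≤s (subst (2 ≤_) (sym (SubP.∣⊤∣≡n k)) 2≤k)
blocks-maximal {k} {false ∷ true ∷ true ∷ Z} _ X∈ = without₀ ne , s≤s (s≤s (nonempty⇒0<∣p∣ ne))
  where
  ne = ∈-nonempties⁻ (∈-join-true⁻ {𝓨 = []} (∈-join-true⁻ {𝓨 = []} (∈-join-false⁻ {𝓧 = blocks-with₀ k} X∈)))
blocks-maximal {k} {false ∷ true ∷ false ∷ Z} _ X∈ =
  contradiction (∈-join-false⁻ {𝓧 = nonempties k} (∈-join-true⁻ {𝓨 = []} (∈-join-false⁻ {𝓧 = blocks-with₀ k} X∈))) λ ()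
blocks-maximal {k} {false ∷ false ∷ Z} _ X∈ =
  contradiction (∈-join-false⁻ {𝓧 = join (nonempties k) []} (∈-join-false⁻ {𝓧 = blocks-with₀ k} X∈)) λ ()

pairs-standard : Pairs {3 + k} (edge ∷ edge′ ∷ [])
pairs-standard {k} = (((λ ()) ∷ []) ∷ [] ∷ []) , (cong (2 +_) (SubP.∣⊥∣≡0 k) ∷ cong (2 +_) (SubP.∣⊥∣≡0 k) ∷ [])

-- Subfamilies of an intersecting family are intersecting, so any `s ∸ 2` of the `blocks` complete
-- the two edges. The whole family has `2 ^ (2 + k)` members, the largest size that occurs.
#extensions-pair-positive : 2 ≤ k → 2 ≤ s → s ≤ 2 ^ (2 + k) → 0 < #extensions s (edge ∷ edge′ {k} ∷ [])
#extensions-pair-positive {k} {s} 2≤k 2≤s s≤ =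
  subst (0 <_) (sym (#extensions≡length s _)) (length-positive (good⇒extension pairs-standard good))
  where
  length-positive : ∀ {a} {A : Set a} {x : A} {xs} → x ∈ xs → 0 < length xs
  length-positive (here _)  = s≤s z≤n
  length-positive (there _) = s≤s z≤n
  m = s ∸ 2
  G = take m (blocks k)
  𝓕 = edge ∷ edge′ ∷ G
  m≤ : m ≤ length (blocks k)
  m≤ = ℕP.+-cancelˡ-≤ 2 _ _ (≤-trans (≤-reflexive (ℕP.m+[n∸m]≡n 2≤s)) (≤-trans s≤ (≤-reflexive (sym (length-blocks k)))))
  ∈-take : ∀ {X} → X ∈ G → X ∈ blocks k
  ∈-take X∈ = subst (_ ∈_) (take++drop≡id m (blocks k)) (∈-++⁺ˡ X∈)
  maximal : ∀ {X} → X ∈ 𝓕 → Maximal X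
  maximal (here refl)         = with₀ (inj₁ refl)
  maximal (there (here refl)) = with₀ (inj₂ (inj₁ refl))
  maximal (there (there X∈))  = proj₁ (blocks-maximal 2≤k (∈-take X∈))
  classify : ∀ {X} → X ∈ 𝓕 → 3 ≤ ∣ X ∣ ⊎ X ∈ edge ∷ edge′ ∷ []
  classify (here X≡)          = inj₂ (here X≡)
  classify (there (here X≡))  = inj₂ (there (here X≡))
  classify (there (there X∈)) = inj₁ (proj₂ (blocks-maximal 2≤k (∈-take X∈)))
  unique : Unique 𝓕
  unique = ++-unique pairs-standard (Uniq.take⁺ m (blocks-unique k)) (λ X∈ → ∈-large⁺ (proj₂ (blocks-maximal 2≤k (∈-take X∈))))
  length-𝓕 : length 𝓕 ≡ s
  length-𝓕 = trans (cong (2 +_) (trans (length-take m (blocks k)) (ℕP.m≤n⇒m⊓n≡m m≤))) (ℕP.m+[n∸m]≡n 2≤s)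
  good : Good s (edge ∷ edge′ ∷ []) (indicatorOf 𝓕)
  good = record
    { large⊎trace = λ F∋ → classify (∋⇒∈ F∋)
    ; trace       = λ X∈ → ∈⇒∋ {𝓕 = 𝓕} (∈-++⁺ˡ {ys = G} X∈)
    ; meet        = λ F∋X F∋Y → maximal-meet (maximal (∋⇒∈ F∋X)) (maximal (∋⇒∈ F∋Y))
    ; size        = trans (↭-length (unique⇒↭ (members-unique (indicatorOf 𝓕)) unique
                      (λ X∈ → ∋⇒∈ (∈-members⁻ {F = indicatorOf 𝓕} X∈))
                      (λ X∈ → ∈-members⁺ {F = indicatorOf 𝓕} (∈⇒∋ X∈)))) length-𝓕
    }

-- Traces with at least three members

⊑∧∣≤∣⇒≡ : {p q : Subset n} → p ⊑ q → ∣ q ∣ ≤ ∣ p ∣ → p ≡ q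
⊑∧∣≤∣⇒≡ {p = p} {q} p⊑q ∣q∣≤∣p∣ = ⊆-antisym p⊑q q⊑p
  where
  q⊑p : q ⊑ p
  q⊑p {x} x∈q with x SubP.∈? p
  ... | yes x∈p = x∈p
  ... | no  x∉p = contradiction ∣q∣≤∣p∣ (ℕP.<⇒≱ (p⊂q⇒∣p∣<∣q∣ (p⊑q , x , x∈q , x∉p)))

pairOf : Fin n → Fin n → Subset n
pairOf x y = ⁅ x ⁆ ∪ ⁅ y ⁆

∈-pairOf⁻ : {x y z : Fin n} → z Sub.∈ pairOf x y → z ≡ x ⊎ z ≡ y
∈-pairOf⁻ {x = x} {y} z∈ with x∈p∪q⁻ ⁅ x ⁆ ⁅ y ⁆ z∈
... | inj₁ z∈x = inj₁ (x∈⁅y⁆⇒x≡y x z∈x)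
... | inj₂ z∈y = inj₂ (x∈⁅y⁆⇒x≡y y z∈y)

pairOf-≡ : {X : Subset n} {x y : Fin n} → ∣ X ∣ ≡ 2 → x Sub.∈ X → y Sub.∈ X → ¬ x ≡ y → X ≡ pairOf x y
pairOf-≡ {X = X} {x} {y} ∣X∣≡2 x∈X y∈X x≢y = sym (⊑∧∣≤∣⇒≡ below (≤-reflexive (trans ∣X∣≡2 (sym ∣pairOf∣))))
  where
  ∣pairOf∣ : ∣ pairOf x y ∣ ≡ 2
  ∣pairOf∣ = trans (∣⁅x⁆∪p∣ (λ x∈y → x≢y (x∈⁅y⁆⇒x≡y y x∈y))) (cong suc (∣⁅x⁆∣≡1 y))
  below : pairOf x y ⊑ X
  below z∈ with ∈-pairOf⁻ z∈
  ... | inj₁ refl = x∈X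
  ... | inj₂ refl = y∈X

pair-other : {X : Subset n} {x : Fin n} → ∣ X ∣ ≡ 2 → x Sub.∈ X → ∃[ y ] y Sub.∈ X × ¬ x ≡ y
pair-other {X = X} {x} ∣X∣≡2 x∈X with nonempty? (X ∩ ∁ ⁅ x ⁆)
... | yes (y , y∈) with x∈p∩q⁻ X (∁ ⁅ x ⁆) y∈
...   | y∈X , y∈∁ = y , y∈X , λ { refl → x∈∁p⇒x∉p y∈∁ (x∈⁅x⁆ x) }
pair-other {X = X} {x} ∣X∣≡2 x∈X | no ¬ne = contradiction
  (subst (_≤ 1) ∣X∣≡2 (subst (∣ X ∣ ≤_) (∣⁅x⁆∣≡1 x) (p⊆q⇒∣p∣≤∣q∣ X⊑)))
  λ { (s≤s ()) }
  where
  X⊑ : X ⊑ ⁅ x ⁆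
  X⊑ y∈X = subst (_ Sub.∈_) (∁-involutive ⁅ x ⁆) (disjoint⇒⊑∁ ¬ne y∈X)

-- The entry `pairOf v v` is the singleton of `v` and not an edge; it is tolerated because only an
-- upper bound on the length matters.
starOf : Fin n → List (Subset n)
starOf {n} v = map (pairOf v) (allFin n)

triangleOf : Fin n → Fin n → Fin n → List (Subset n)
triangleOf u v w = pairOf u v ∷ pairOf u w ∷ pairOf v w ∷ []

PairwiseMeeting : Family n → Set
PairwiseMeeting T = ∀ {X Y} → X ∈ T → Y ∈ T → Nonempty (X ∩ Y)

-- Let the first two members be `{v, a}` and `{v, b}`. A member without `v` meets both, so it is
-- `{a, b}`. If there is one, every member through `v` must meet it in `a` or `b`.
star⊎triangle : {X Y : Subset n} {T : Family n} → Pairs (X ∷ Y ∷ T) → PairwiseMeeting (X ∷ Y ∷ T) →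
  (∃[ v ] All (v Sub.∈_) (X ∷ Y ∷ T)) ⊎ (∃[ u ] ∃[ v ] ∃[ w ] All (_∈ triangleOf u v w) (X ∷ Y ∷ T))
star⊎triangle {X = X} {Y} {T} pairs@(_ , two) meets with meets (here refl) (there (here refl))
... | v , v∈ with all? (v SubP.∈?_) (X ∷ Y ∷ T)
...   | yes star = inj₁ (v , star)
...   | no ¬star with find (¬All⇒Any¬ (v SubP.∈?_) (X ∷ Y ∷ T) ¬star) | x∈p∩q⁻ X Y v∈
...     | W , W∈ , v∉W | v∈X , v∈Y
          with pair-other (All.lookup two (here refl)) v∈X | pair-other (All.lookup two (there (here refl))) v∈Y
...       | a , a∈X , v≢a | b , b∈Y , v≢b = inj₂ (v , a , b , All.tabulate inTriangle)
  where
  ∈X⇒ : ∀ {z} → z Sub.∈ X → z ≡ v ⊎ z ≡ a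
  ∈X⇒ z∈ = ∈-pairOf⁻ (subst (_ Sub.∈_) (pairOf-≡ (All.lookup two (here refl)) v∈X a∈X v≢a) z∈)
  ∈Y⇒ : ∀ {z} → z Sub.∈ Y → z ≡ v ⊎ z ≡ b
  ∈Y⇒ z∈ = ∈-pairOf⁻ (subst (_ Sub.∈_) (pairOf-≡ (All.lookup two (there (here refl))) v∈Y b∈Y v≢b) z∈)
  a≢b : ¬ a ≡ b
  a≢b refl = pairs-∉ pairs (here refl) (trans (pairOf-≡ (All.lookup two (there (here refl))) v∈Y b∈Y v≢b)
    (sym (pairOf-≡ (All.lookup two (here refl)) v∈X a∈X v≢a)))
  avoiding : ∀ {S} → S ∈ X ∷ Y ∷ T → ¬ v Sub.∈ S → S ≡ pairOf a b
  avoiding {S} S∈ v∉S = pairOf-≡ (All.lookup two S∈) a∈S b∈S a≢b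
    where
    a∈S : a Sub.∈ S
    a∈S with meets S∈ (here refl)
    ... | z , z∈ with x∈p∩q⁻ S X z∈
    ...   | z∈S , z∈X with ∈X⇒ z∈X
    ...     | inj₁ refl = contradiction z∈S v∉S
    ...     | inj₂ refl = z∈S
    b∈S : b Sub.∈ S
    b∈S with meets S∈ (there (here refl))
    ... | z , z∈ with x∈p∩q⁻ S Y z∈
    ...   | z∈S , z∈Y with ∈Y⇒ z∈Y
    ...     | inj₁ refl = contradiction z∈S v∉S
    ...     | inj₂ refl = z∈S
  inTriangle : ∀ {S} → S ∈ X ∷ Y ∷ T → S ∈ triangleOf v a b
  inTriangle {S} S∈ with v SubP.∈? S
  ... | no  v∉S = there (there (here (avoiding S∈ v∉S)))
  ... | yes v∈S with meets S∈ W∈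
  ...   | z , z∈ with x∈p∩q⁻ S W z∈
  ...     | z∈S , z∈W with ∈-pairOf⁻ (subst (z Sub.∈_) (avoiding W∈ v∉W) z∈W)
  ...       | inj₁ refl = here (pairOf-≡ (All.lookup two S∈) v∈S z∈S v≢a)
  ...       | inj₂ refl = there (here (pairOf-≡ (All.lookup two S∈) v∈S z∈S v≢b))

-- A single family with trace `T` suffices: `T` is then part of an intersecting family.
#extensions-meeting : {T : Family n} → Pairs T → #extensions s T ≡ 0 ⊎ PairwiseMeeting T
#extensions-meeting {s = s} {T} pairs with extensions s T in eq
... | []    = inj₁ (trans (#extensions≡length s T) (cong length eq))
... | G ∷ _ = inj₂ λ X∈ Y∈ → meet good (trace good X∈) (trace good Y∈)
  where
  good : Good s T (indicatorOf (T ++ G))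
  good = extension⇒good pairs (subst (G ∈_) (sym eq) (here refl))

-- The number of families whose trace is a given pair of intersecting edges.
γ : ℕ → ℕ → ℕ
γ s k = #extensions s (edge ∷ edge′ {k} ∷ [])

module Bounds (s j : ℕ) where

  n₀ : ℕ
  n₀ = 6 + j

  g : Family n₀ → ℕ
  g = #extensions s

  γ₀ : ℕ
  γ₀ = γ s (3 + j)

  -- For n = 6 + j these are 2^(n-5), the gain in removing an edge from a trace of three, and
  -- 2^(n-6), the gain in removing one from a star of four.
  K L : ℕ
  K = 2 ^ (1 + j)
  L = 2 ^ j

  zero-≤ : ∀ {m} c {o} → m ≡ 0 → m * c ≤ o
  zero-≤ c refl = z≤n

  bound₃ : ∀ {X Y Z} → Pairs (X ∷ Y ∷ Z ∷ []) → g (X ∷ Y ∷ Z ∷ []) * K ≤ γ₀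
  bound₃ {X} {Y} {Z} pairs with #extensions-meeting {s = s} pairs
  ... | inj₁ g≡0   = zero-≤ K g≡0
  ... | inj₂ meets with meets (here refl) (there (here refl))
  ...   | v , v∈ with x∈p∩q⁻ X Y v∈ | v SubP.∈? Z
  ...     | v∈X , v∈Y | yes v∈Z = ≤-trans
    (#extensions-star pairs v∈X (v∈Y ∷ v∈Z ∷ []) (s≤s (s≤s z≤n)) (≤-reflexive (solve-d j)))
    (≤-reflexive (#extensions-pair (pairs-tail pairs) (meets (there (here refl)) (there (there (here refl))))))
    where
    solve-d : ∀ j → suc (1 + j + 2) ≡ 4 + j
    solve-d = solve-∀
  ...     | v∈X , v∈Y | no v∉Z = ≤-trans
    (#extensions-triangle pairs v∈X v∈Y v∉Z (meets (here refl) (there (there (here refl))))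
      (meets (there (here refl)) (there (there (here refl)))) ≤-refl)
    (≤-reflexive (#extensions-pair (pairs-tail pairs) (meets (there (here refl)) (there (there (here refl))))))

  triangle-short : {T : Family n₀} {u v w : Fin n₀} → Unique T → All (_∈ triangleOf u v w) T → length T ≤ 3
  triangle-short uT T⊆ = length-mono-∈ uT (All.lookup T⊆)

  -- Longer traces are first cut down to four edges by `#extensions-∷-≤`, without any gain. Four
  -- pairwise meeting edges do not fit into a triangle, so they form a star and both gains apply.
  bound₄ : ∀ {W X Y Z T} → Pairs (W ∷ X ∷ Y ∷ Z ∷ T) → g (W ∷ X ∷ Y ∷ Z ∷ T) * (L * K) ≤ γ₀
  bound₄ {T = V ∷ T} pairs = ≤-trans
    (ℕP.*-monoˡ-≤ (L * K) (#extensions-∷-≤ (s≤s (s≤s (s≤s z≤n))) pairs))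
    (bound₄ (pairs-tail pairs))
  bound₄ {W} {X} {Y} {Z} {[]} pairs with #extensions-meeting {s = s} pairs
  ... | inj₁ g≡0   = zero-≤ (L * K) g≡0
  ... | inj₂ meets with star⊎triangle pairs meets
  ...   | inj₂ (u , v , w , T⊆) = contradiction (triangle-short (proj₁ pairs) T⊆) λ { (s≤s (s≤s (s≤s ()))) }
  ...   | inj₁ (v , v∈W ∷ v∈T) = begin
    g (W ∷ X ∷ Y ∷ Z ∷ []) * (L * K) ≡⟨ ℕP.*-assoc (g (W ∷ X ∷ Y ∷ Z ∷ [])) L K ⟨
    g (W ∷ X ∷ Y ∷ Z ∷ []) * L * K   ≤⟨ ℕP.*-monoˡ-≤ K (#extensions-star pairs v∈W v∈T (s≤s (s≤s z≤n)) (≤-reflexive (solve-d j))) ⟩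
    g (X ∷ Y ∷ Z ∷ []) * K           ≤⟨ bound₃ (pairs-tail pairs) ⟩
    γ₀                               ∎
    where
    open ℕP.≤-Reasoning
    solve-d : ∀ j → suc (j + 3) ≡ 4 + j
    solve-d = solve-∀

-- Binomial coefficients and the numerical inequality

exactly : ∀ {a} {A : Set a} → ℕ → List A → ℕ
exactly zero    []      = 1
exactly zero    (_ ∷ _) = 0
exactly (suc k) []      = 0
exactly (suc k) (_ ∷ T) = exactly k T

sumSub-exactly : ∀ {a} {A : Set a} k (xs : List A) → sumSub (exactly k) xs ≡ length xs C k
sumSub-exactly zero    []       = refl
sumSub-exactly (suc k) []       = refl
sumSub-exactly zero    (x ∷ xs) = trans (cong₂ _+_ (sumSub-exactly 0 xs) (sumSub-* 0 (λ _ → 0) xs)) refl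
sumSub-exactly (suc k) (x ∷ xs) = begin
  sumSub (exactly (suc k)) xs + sumSub (exactly k) xs
    ≡⟨ cong₂ _+_ (sumSub-exactly (suc k) xs) (sumSub-exactly k xs) ⟩
  length xs C suc k + length xs C k
    ≡⟨ ℕP.+-comm (length xs C suc k) _ ⟩
  length xs C k + length xs C suc k
    ≡⟨ nCk+nC[k+1]≡[n+1]C[k+1] (length xs) k ⟩
  suc (length xs) C suc k ∎
  where open ≡-Reasoning

sumSub-1 : ∀ {a} {A : Set a} (xs : List A) → sumSub (λ _ → 1) xs ≡ 2 ^ length xs
sumSub-1 []       = refl
sumSub-1 (x ∷ xs) = cong₂ _+_ (sumSub-1 xs) (trans (sumSub-1 xs) (sym (+-identityʳ _)))

C-monoˡ-≤ : ∀ k {m n} → m ≤ n → m C k ≤ n C k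
C-monoˡ-≤ k {m} m≤n with ℕP.m≤n⇒∃[o]m+o≡n m≤n
... | o , refl = subst (λ t → m C k ≤ t C k) (ℕP.+-comm o m) (steps o)
  where
  step : ∀ k n → n C k ≤ suc n C k
  step zero    n = ≤-refl
  step (suc k) n = subst (n C suc k ≤_) (nCk+nC[k+1]≡[n+1]C[k+1] n k) (m≤n+m _ _)
  steps : ∀ o → m C k ≤ (o + m) C k
  steps zero    = ≤-refl
  steps (suc o) = ≤-trans (steps o) (step k (o + m))

2*nC2+n≡n² : ∀ n → 2 * (n C 2) + n ≡ n * n
2*nC2+n≡n² zero    = refl
2*nC2+n≡n² (suc n) = begin
  2 * (suc n C 2) + suc n          ≡⟨ cong (λ c → 2 * c + suc n) (nCk+nC[k+1]≡[n+1]C[k+1] n 1) ⟨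
  2 * (n C 1 + n C 2) + suc n      ≡⟨ cong (λ c → 2 * (c + n C 2) + suc n) (nC1≡n n) ⟩
  2 * (n + n C 2) + suc n          ≡⟨ rearrange n (n C 2) ⟩
  2 * (n C 2) + n + (2 * n + 1)    ≡⟨ cong (_+ (2 * n + 1)) (2*nC2+n≡n² n) ⟩
  n * n + (2 * n + 1)              ≡⟨ square n ⟩
  suc n * suc n ∎
  where
  open ≡-Reasoning
  rearrange : ∀ n c → 2 * (n + c) + suc n ≡ 2 * c + n + (2 * n + 1)
  rearrange = solve-∀
  square : ∀ n → n * n + (2 * n + 1) ≡ suc n * suc n
  square = solve-∀

6*nC3≤n³ : ∀ n → 6 * (n C 3) ≤ n * n * n
6*nC3≤n³ zero    = z≤n
6*nC3≤n³ (suc n) = begin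
  6 * (suc n C 3)                          ≡⟨ cong (6 *_) (nCk+nC[k+1]≡[n+1]C[k+1] n 2) ⟨
  6 * (n C 2 + n C 3)                      ≡⟨ rearrange (n C 2) (n C 3) ⟩
  6 * (n C 3) + 3 * (2 * (n C 2))          ≤⟨ +-mono-≤ (6*nC3≤n³ n) (ℕP.*-monoʳ-≤ 3 (≤-trans (m≤m+n _ n) (≤-reflexive (2*nC2+n≡n² n)))) ⟩
  n * n * n + 3 * (n * n)                  ≤⟨ m≤m+n _ (3 * n + 1) ⟩
  n * n * n + 3 * (n * n) + (3 * n + 1)    ≡⟨ cube n ⟩
  suc n * suc n * suc n ∎
  where
  open ℕP.≤-Reasoning
  rearrange : ∀ c d → 6 * (c + d) ≡ 6 * d + 3 * (2 * c)
  rearrange = solve-∀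
  cube : ∀ n → n * n * n + 3 * (n * n) + (3 * n + 1) ≡ suc n * suc n * suc n
  cube = solve-∀

-- 2^(n-6) poly(n) bounds six times the coefficient below, which weighs the n stars
-- and n³ triangles.
poly : ℕ → ℕ
poly n = n * n * n * n + 7 * (n * n * n) + 384 * n

-- Here the number 21 is decided: the base case reads 267372 < 393216, while for 20 points the two
-- sides would be 223680 and 196608. In the induction the right side doubles and the left side at
-- most doubles.
poly-bound-from-21 : ∀ m → poly (21 + m) < 12 * 2 ^ (15 + m)
poly-bound-from-21 zero    = ℕP.<ᵇ⇒< _ _ tt
poly-bound-from-21 (suc m) = begin-strict
  poly (21 + suc m)
    ≤⟨ m≤m+n _ _ ⟩
  -- The added polynomial is `2 * poly (21 + m)` minus `poly (22 + m)`; the shift by 21 makes all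
  -- its coefficients positive.
  poly (21 + suc m) + (m * m * m * m + 87 * (m * m * m) + 2808 * (m * m) + 40238 * m + 217504)
    ≡⟨ doubling m ⟩
  2 * poly (21 + m)
    <⟨ ℕP.*-monoʳ-< 2 (poly-bound-from-21 m) ⟩
  2 * (12 * 2 ^ (15 + m))
    ≡⟨ swap-factors (2 ^ (15 + m)) ⟩
  12 * 2 ^ (15 + suc m) ∎
  where
  open ℕP.≤-Reasoning
  swap-factors : ∀ p → 2 * (12 * p) ≡ 12 * (2 * p)
  swap-factors = solve-∀
  doubling : ∀ m → poly (21 + suc m) + (m * m * m * m + 87 * (m * m * m) + 2808 * (m * m) + 40238 * m + 217504) ≡ 2 * poly (21 + m)
  doubling m = identity m
    where
    identity : ∀ m →
      (22 + m) * (22 + m) * (22 + m) * (22 + m) + 7 * ((22 + m) * (22 + m) * (22 + m)) + 384 * (22 + m)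
        + (m * m * m * m + 87 * (m * m * m) + 2808 * (m * m) + 40238 * m + 217504) ≡
      2 * ((21 + m) * (21 + m) * (21 + m) * (21 + m) + 7 * ((21 + m) * (21 + m) * (21 + m)) + 384 * (21 + m))
    identity = solve-∀

poly-bound : ∀ {j} → 15 ≤ j → poly (6 + j) < 12 * 2 ^ j
poly-bound {j} 15≤j = subst (λ j → poly (6 + j) < 12 * 2 ^ j) (ℕP.m+[n∸m]≡n 15≤j) (poly-bound-from-21 (j ∸ 15))

pairs-sublist : {T 𝓑 : Family n} → T ⊆ 𝓑 → Pairs 𝓑 → Pairs T
pairs-sublist sub (u , two) = unique-resp-⊆ sub u , All-resp-⊆ sub two

*-sum-map-≤ : ∀ {b} {B : Set b} (c : ℕ) (f : B → ℕ) {d} (J : List B) → (∀ {j} → j ∈ J → c * f j ≤ d) →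
  c * sum (map f J) ≤ length J * d
*-sum-map-≤ c f []      f≤ = ≤-reflexive (*-zeroʳ c)
*-sum-map-≤ c f (j ∷ J) f≤ = ≤-trans (≤-reflexive (*-distribˡ-+ c (f j) _))
  (+-mono-≤ (f≤ (here refl)) (*-sum-map-≤ c f J (λ j∈ → f≤ (there j∈))))

length-allFin : ∀ n → length (allFin n) ≡ n
length-allFin n = length-tabulate (λ x → x)

-- The total contribution of traces with at least three members

module LargeTraces (s j : ℕ) (48≤L : 48 ≤ 2 ^ j) (poly-small : poly (6 + j) < 12 * 2 ^ j) where

  open Bounds s j

  -- In units of γ₀ and after multiplication by `L * K`, a trace of three edges costs at most `L`
  -- and a longer one at most 1. Charging the 1 to every sublist keeps the sum in closed form.
  weight : Family n₀ → ℕ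
  weight T = L * exactly 3 T + 1

  weighted : ∀ T → Pairs T → (L * K) * from₃ g T ≤ γ₀ * weight T
  weighted []           _     = ≤-trans (≤-reflexive (*-zeroʳ (L * K))) z≤n
  weighted (_ ∷ [])     _     = ≤-trans (≤-reflexive (*-zeroʳ (L * K))) z≤n
  weighted (_ ∷ _ ∷ []) _     = ≤-trans (≤-reflexive (*-zeroʳ (L * K))) z≤n
  weighted T@(_ ∷ _ ∷ _ ∷ []) pairs = begin
    (L * K) * g T    ≡⟨ rearrange L K (g T) ⟩
    L * (g T * K)    ≤⟨ ℕP.*-monoʳ-≤ L (bound₃ pairs) ⟩
    L * γ₀           ≤⟨ m≤m+n _ γ₀ ⟩
    L * γ₀ + γ₀      ≡⟨ collect L γ₀ ⟩
    γ₀ * (L * 1 + 1) ∎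
    where
    open ℕP.≤-Reasoning
    rearrange : ∀ l κ t → (l * κ) * t ≡ l * (t * κ)
    rearrange = solve-∀
    collect : ∀ l c → l * c + c ≡ c * (l * 1 + 1)
    collect = solve-∀
  weighted T@(_ ∷ _ ∷ _ ∷ _ ∷ _) pairs = begin
    (L * K) * g T    ≡⟨ ℕP.*-comm (L * K) (g T) ⟩
    g T * (L * K)    ≤⟨ bound₄ pairs ⟩
    γ₀               ≡⟨ collect L γ₀ ⟩
    γ₀ * (L * 0 + 1) ∎
    where
    open ℕP.≤-Reasoning
    collect : ∀ l c → c ≡ c * (l * 0 + 1)
    collect = solve-∀

  local : ∀ {d} (𝓑 : Family n₀) → Pairs 𝓑 → length 𝓑 ≤ d →
    (L * K) * sumSub (from₃ g) 𝓑 ≤ γ₀ * (L * (d C 3) + 2 ^ d)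
  local {d} 𝓑 pairs 𝓑≤d = begin
    (L * K) * sumSub (from₃ g) 𝓑          ≡⟨ sumSub-* (L * K) (from₃ g) 𝓑 ⟨
    sumSub (λ T → (L * K) * from₃ g T) 𝓑  ≤⟨ sumSub-mono 𝓑 (λ {T} sub → weighted T (pairs-sublist sub pairs)) ⟩
    sumSub (λ T → γ₀ * weight T) 𝓑        ≡⟨ sumSub-* γ₀ weight 𝓑 ⟩
    γ₀ * sumSub weight 𝓑                  ≡⟨ cong (γ₀ *_) (sumSub-+ (λ T → L * exactly 3 T) (λ _ → 1) 𝓑) ⟩
    γ₀ * (sumSub (λ T → L * exactly 3 T) 𝓑 + sumSub (λ _ → 1) 𝓑)
      ≡⟨ cong (γ₀ *_) (cong₂ _+_ (trans (sumSub-* L (exactly 3) 𝓑) (cong (L *_) (sumSub-exactly 3 𝓑))) (sumSub-1 𝓑)) ⟩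
    γ₀ * (L * (length 𝓑 C 3) + 2 ^ length 𝓑)
      ≤⟨ ℕP.*-monoʳ-≤ γ₀ (+-mono-≤ (ℕP.*-monoʳ-≤ L (C-monoˡ-≤ 3 𝓑≤d)) (ℕP.^-monoʳ-≤ 2 𝓑≤d)) ⟩
    γ₀ * (L * (d C 3) + 2 ^ d) ∎
    where open ℕP.≤-Reasoning

  points : List (Fin n₀)
  points = allFin n₀

  -- Ordered triples with repetition: counting each triangle six times and admitting degenerate ones
  -- is cheap enough for the final inequality.
  triples : List (Fin n₀ × Fin n₀ × Fin n₀)
  triples = cartesianProduct points (cartesianProduct points points)

  triangleAt : Fin n₀ × Fin n₀ × Fin n₀ → List (Subset n₀)
  triangleAt (u , v , w) = triangleOf u v w

  stars triangles : List (List (Subset n₀))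
  stars     = map starOf points
  triangles = map triangleAt triples

  covered : ∀ {T} → Pairs T → from₃ g T ≡ 0 ⊎ ∃[ 𝓛 ] 𝓛 ∈ stars ++ triangles × All (_∈ 𝓛) T
  covered {[]}         _ = inj₁ refl
  covered {_ ∷ []}     _ = inj₁ refl
  covered {_ ∷ _ ∷ []} _ = inj₁ refl
  covered {T@(_ ∷ _ ∷ _ ∷ _)} pairs with #extensions-meeting {s = s} pairs
  ... | inj₁ g≡0   = inj₁ g≡0
  ... | inj₂ meets with star⊎triangle pairs meets
  ...   | inj₁ (v , v∈) = inj₂ (starOf v , ∈-++⁺ˡ (∈-map⁺ starOf {xs = points} (∈-allFin v)) ,
    All.tabulate λ X∈ → inStar (All.lookup (proj₂ pairs) X∈) (All.lookup v∈ X∈))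
    where
    inStar : ∀ {X} → ∣ X ∣ ≡ 2 → v Sub.∈ X → X ∈ starOf v
    inStar ∣X∣≡2 v∈X with pair-other ∣X∣≡2 v∈X
    ... | y , y∈X , v≢y = subst (_∈ starOf v) (sym (pairOf-≡ ∣X∣≡2 v∈X y∈X v≢y)) (∈-map⁺ (pairOf v) (∈-allFin y))
  ...   | inj₂ (u , v , w , T⊆) = inj₂ (triangleOf u v w , ∈-++⁺ʳ stars (∈-map⁺ triangleAt {x = u , v , w} {xs = triples}
    (∈-cartesianProduct⁺ (∈-allFin u) (∈-cartesianProduct⁺ (∈-allFin v) (∈-allFin w)))) , T⊆)

  -- These are the bounds of `local` for d = n₀ and for d = 3, where there is one sublist of length
  -- three and 8 sublists in all.
  starCost triangleCost : ℕ
  starCost     = γ₀ * (L * (n₀ C 3) + 2 ^ n₀)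
  triangleCost = γ₀ * (L * 1 + 8)

  module _ {𝓑 : Family n₀} (pairs : Pairs 𝓑) where

    within : List (Subset n₀) → ℕ
    within 𝓛 = sumSub (from₃ g) (filter (_∈? 𝓛) 𝓑)

    within-≤ : ∀ 𝓛 {d} → length 𝓛 ≤ d → (L * K) * within 𝓛 ≤ γ₀ * (L * (d C 3) + 2 ^ d)
    within-≤ 𝓛 𝓛≤d = local (filter (_∈? 𝓛) 𝓑)
      (Uniq.filter⁺ (_∈? 𝓛) (proj₁ pairs) , AllP.filter⁺ (_∈? 𝓛) (proj₂ pairs))
      (≤-trans (length-mono-∈ (Uniq.filter⁺ (_∈? 𝓛) (proj₁ pairs)) (λ X∈ → proj₂ (∈-filter⁻ (_∈? 𝓛) {xs = 𝓑} X∈))) 𝓛≤d)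

    stars-≤ : (L * K) * sum (map within stars) ≤ n₀ * starCost
    stars-≤ = ≤-trans (*-sum-map-≤ (L * K) within stars bound)
      (≤-reflexive (cong (_* starCost) (trans (length-map starOf points) (length-allFin n₀))))
      where
      bound : ∀ {𝓛} → 𝓛 ∈ stars → (L * K) * within 𝓛 ≤ starCost
      bound 𝓛∈ with ∈-map⁻ starOf {xs = points} 𝓛∈
      ... | v , _ , refl = within-≤ (starOf v) (≤-reflexive (trans (length-map (pairOf v) points) (length-allFin n₀)))

    triangles-≤ : (L * K) * sum (map within triangles) ≤ n₀ * (n₀ * n₀) * triangleCost
    triangles-≤ = ≤-trans (*-sum-map-≤ (L * K) within triangles bound)
      (≤-reflexive (cong (_* triangleCost) length-triangles))
      where
      bound : ∀ {𝓛} → 𝓛 ∈ triangles → (L * K) * within 𝓛 ≤ triangleCost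
      bound 𝓛∈ with ∈-map⁻ triangleAt {xs = triples} 𝓛∈
      ... | (u , v , w) , _ , refl = within-≤ (triangleOf u v w) ≤-refl
      length-triangles : length triangles ≡ n₀ * (n₀ * n₀)
      length-triangles = trans (length-map triangleAt triples) (trans
        (length-cartesianProduct points (cartesianProduct points points))
        (cong₂ _*_ (length-allFin n₀) (trans (length-cartesianProduct points points) (cong₂ _*_ (length-allFin n₀) (length-allFin n₀)))))

    total-≤ : (L * K) * sumSub (from₃ g) 𝓑 ≤ n₀ * starCost + n₀ * (n₀ * n₀) * triangleCost
    total-≤ = begin
      (L * K) * sumSub (from₃ g) 𝓑
        ≤⟨ ℕP.*-monoʳ-≤ (L * K) (sumSub-cover _≟ˢ_ (from₃ g) (stars ++ triangles) 𝓑 (λ sub → covered (pairs-sublist sub pairs))) ⟩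
      (L * K) * sum (map within (stars ++ triangles))
        ≡⟨ cong ((L * K) *_) (trans (cong sum (map-++ within stars triangles)) (sum-++ (map within stars) _)) ⟩
      (L * K) * (sum (map within stars) + sum (map within triangles))
        ≡⟨ *-distribˡ-+ (L * K) (sum (map within stars)) _ ⟩
      (L * K) * sum (map within stars) + (L * K) * sum (map within triangles)
        ≤⟨ +-mono-≤ stars-≤ triangles-≤ ⟩
      n₀ * starCost + n₀ * (n₀ * n₀) * triangleCost ∎
      where open ℕP.≤-Reasoning

  coefficient : ℕ
  coefficient = n₀ * (L * (n₀ C 3) + 2 ^ n₀) + n₀ * (n₀ * n₀) * (L * 1 + 8)

  collect : ∀ c n a b → n * (c * a) + n * (n * n) * (c * b) ≡ (n * a + n * (n * n) * b) * c
  collect = solve-∀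

  -- The factor 6 clears the denominator of `n₀ C 3`. It turns 2^n₀ = 64 `L` into 384 `L` and the 8
  -- sublists of a triangle into 48, which `48≤L` absorbs as a seventh cubic term. On the right, 6
  -- `L * K` is 12 times the square of `L`.
  coefficient-small : coefficient < L * K
  coefficient-small = ℕP.*-cancelˡ-< 6 _ _ (begin-strict
    6 * coefficient
      ≡⟨ expand n₀ L (n₀ C 3) ⟩
    L * (n₀ * (6 * (n₀ C 3))) + L * (384 * n₀) + (L * (6 * (n₀ * (n₀ * n₀))) + 48 * (n₀ * (n₀ * n₀)))
      ≤⟨ +-mono-≤ (ℕP.+-monoˡ-≤ (L * (384 * n₀)) (ℕP.*-monoʳ-≤ L (ℕP.*-monoʳ-≤ n₀ (6*nC3≤n³ n₀))))
           (+-monoʳ-≤ (L * (6 * (n₀ * (n₀ * n₀)))) (ℕP.*-monoˡ-≤ (n₀ * (n₀ * n₀)) 48≤L)) ⟩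
    L * (n₀ * (n₀ * n₀ * n₀)) + L * (384 * n₀) + (L * (6 * (n₀ * (n₀ * n₀))) + L * (n₀ * (n₀ * n₀)))
      ≡⟨ factor n₀ L ⟩
    L * poly n₀
      <⟨ ℕP.*-monoʳ-< L {{ℕP.m^n≢0 2 j}} poly-small ⟩
    L * (12 * L)
      ≡⟨ regroup L ⟩
    6 * (L * K) ∎)
    where
    open ℕP.≤-Reasoning
    expand : ∀ n l c → 6 * (n * (l * c + 2 * (2 * (2 * (2 * (2 * (2 * l)))))) + n * (n * n) * (l * 1 + 8)) ≡
      l * (n * (6 * c)) + l * (384 * n) + (l * (6 * (n * (n * n))) + 48 * (n * (n * n)))
    expand = solve-∀
    factor : ∀ n l → l * (n * (n * n * n)) + l * (384 * n) + (l * (6 * (n * (n * n))) + l * (n * (n * n))) ≡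
      l * (n * n * n * n + 7 * (n * n * n) + 384 * n)
    factor = solve-∀
    regroup : ∀ l → l * (12 * l) ≡ 6 * (l * (2 * l))
    regroup = solve-∀

  large-traces-< : {𝓑 : Family n₀} → Pairs 𝓑 → 0 < γ₀ → sumSub (from₃ g) 𝓑 < γ₀
  large-traces-< {𝓑} pairs 0<γ = ℕP.*-cancelˡ-< (L * K) _ _ (begin-strict
    (L * K) * sumSub (from₃ g) 𝓑                              ≤⟨ total-≤ pairs ⟩
    n₀ * starCost + n₀ * (n₀ * n₀) * triangleCost             ≡⟨ collect γ₀ n₀ (L * (n₀ C 3) + 2 ^ n₀) (L * 1 + 8) ⟩
    coefficient * γ₀                                          <⟨ ℕP.*-monoˡ-< γ₀ {{>-nonZero 0<γ}} coefficient-small ⟩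
    (L * K) * γ₀                                              ∎)
    where open ℕP.≤-Reasoning

-- Comparison of two families of edges

length-filter-map : ∀ {a b p q} {A : Set a} {B : Set b} {P : B → Set p} {Q : A → Set q}
  (P? : ∀ y → Dec (P y)) (Q? : ∀ x → Dec (Q x))
  (f : A → B) → (∀ x → does (P? (f x)) ≡ does (Q? x)) → ∀ xs → length (filter P? (map f xs)) ≡ length (filter Q? xs)
length-filter-map P? Q? f eq []       = refl
length-filter-map P? Q? f eq (x ∷ xs) rewrite eq x with does (Q? x)
... | true  = cong suc (length-filter-map P? Q? f eq xs)
... | false = length-filter-map P? Q? f eq xs

#ofSize : ∀ n k → length (filter (λ X → ∣ X ∣ ≟ k) (allSubsets n)) ≡ n C k
#ofSize zero    zero    = refl
#ofSize zero    (suc k) = refl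
#ofSize (suc n) k       = begin
  length (filter (λ X → ∣ X ∣ ≟ k) (allSubsets (suc n)))
    ≡⟨ cong length (filter-++ (λ X → ∣ X ∣ ≟ k) (map (true ∷_) (allSubsets n)) _) ⟩
  length (filter (λ X → ∣ X ∣ ≟ k) (map (true ∷_) (allSubsets n)) ++ filter (λ X → ∣ X ∣ ≟ k) (map (false ∷_) (allSubsets n)))
    ≡⟨ length-++ (filter (λ X → ∣ X ∣ ≟ k) (map (true ∷_) (allSubsets n))) ⟩
  length (filter (λ X → ∣ X ∣ ≟ k) (map (true ∷_) (allSubsets n))) + length (filter (λ X → ∣ X ∣ ≟ k) (map (false ∷_) (allSubsets n)))
    ≡⟨ cong (length (filter (λ X → ∣ X ∣ ≟ k) (map (true ∷_) (allSubsets n))) +_)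
         (trans (length-filter-map (λ X → ∣ X ∣ ≟ k) (λ X → ∣ X ∣ ≟ k) (false ∷_) (λ _ → refl) (allSubsets n)) (#ofSize n k)) ⟩
  length (filter (λ X → ∣ X ∣ ≟ k) (map (true ∷_) (allSubsets n))) + n C k
    ≡⟨ containing k ⟩
  suc n C k ∎
  where
  open ≡-Reasoning
  containing : ∀ k → length (filter (λ X → ∣ X ∣ ≟ k) (map (true ∷_) (allSubsets n))) + n C k ≡ suc n C k
  containing zero    = cong (_+ 1) (cong length (filter-none (λ X → ∣ X ∣ ≟ 0) (AllP.map⁺ (All.universal (λ _ ()) (allSubsets n)))))
  containing (suc k) = trans
    (cong (_+ n C suc k) (trans
      (length-filter-map (λ X → ∣ X ∣ ≟ suc k) (λ X → ∣ X ∣ ≟ k) (true ∷_) (λ _ → refl) (allSubsets n)) (#ofSize n k)))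
    (nCk+nC[k+1]≡[n+1]C[k+1] n k)

length-filter-⊎ : ∀ {a p q r} {A : Set a} {P : A → Set p} {Q : A → Set q} {R : A → Set r}
  (P? : ∀ x → Dec (P x)) (Q? : ∀ x → Dec (Q x)) (R? : ∀ x → Dec (R x)) →
  (∀ {x} → P x → Q x ⊎ R x) → (∀ {x} → Q x → P x) → (∀ {x} → R x → P x) → (∀ {x} → Q x → ¬ R x) →
  ∀ xs → length (filter P? xs) ≡ length (filter Q? xs) + length (filter R? xs)
length-filter-⊎ P? Q? R? split Q⇒P R⇒P Q⇒¬R []       = refl
length-filter-⊎ P? Q? R? split Q⇒P R⇒P Q⇒¬R (x ∷ xs)
  with ih ← length-filter-⊎ P? Q? R? split Q⇒P R⇒P Q⇒¬R xs | P? x | Q? x | R? x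
... | _     | yes q | yes r = contradiction r (Q⇒¬R q)
... | yes _ | yes _ | no _  = cong suc ih
... | yes _ | no _  | yes _ = trans (cong suc ih) (sym (ℕP.+-suc _ _))
... | no _  | no _  | no _  = ih
... | yes p | no ¬q | no ¬r = contradiction (split p) Sum.[ ¬q , ¬r ]
... | no ¬p | yes q | no _  = contradiction (Q⇒P q) ¬p
... | no ¬p | no _  | yes r = contradiction (R⇒P r) ¬p

length-filter-≤ : ∀ {a} {A : Set a} (f : A → ℕ) k xs →
  length (filter (λ x → k ≤? f x) xs) ≡ length (filter (λ x → f x ≟ k) xs) + length (filter (λ x → suc k ≤? f x) xs)
length-filter-≤ f k = length-filter-⊎ (λ x → k ≤? f x) (λ x → f x ≟ k) (λ x → suc k ≤? f x)
  (λ k≤f → Sum.swap (Sum.map₂ sym (ℕP.m≤n⇒m<n∨m≡n k≤f)))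
  (λ f≡k → ≤-reflexive (sym f≡k)) ℕP.<⇒≤ (λ f≡k k<f → ℕP.<⇒≢ k<f (sym f≡k))

#atLeast : ∀ n k m → length (filter (λ X → k ≤? ∣ X ∣) (allSubsets n)) ≡
  sum (map (λ j → n C (k + j)) (upTo m)) + length (filter (λ X → (k + m) ≤? ∣ X ∣) (allSubsets n))
#atLeast n k zero    = cong (λ l → length (filter (λ X → l ≤? ∣ X ∣) (allSubsets n))) (sym (+-identityʳ k))
#atLeast n k (suc m) = begin
  length (filter (λ X → k ≤? ∣ X ∣) (allSubsets n))
    ≡⟨ #atLeast n k m ⟩
  S m + length (filter (λ X → (k + m) ≤? ∣ X ∣) (allSubsets n))
    ≡⟨ cong (S m +_) (trans (length-filter-≤ ∣_∣ (k + m) (allSubsets n)) (cong (_+ U) (#ofSize n (k + m)))) ⟩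
  S m + (n C (k + m) + U)
    ≡⟨ +-assoc (S m) _ U ⟨
  S m + n C (k + m) + U
    ≡⟨ cong₂ _+_ (sym S-suc) (cong (λ l → length (filter (λ X → l ≤? ∣ X ∣) (allSubsets n))) (sym (ℕP.+-suc k m))) ⟩
  S (suc m) + length (filter (λ X → (k + suc m) ≤? ∣ X ∣) (allSubsets n)) ∎
  where
  open ≡-Reasoning
  S : ℕ → ℕ
  S m = sum (map (λ j → n C (k + j)) (upTo m))
  U = length (filter (λ X → suc (k + m) ≤? ∣ X ∣) (allSubsets n))
  S-suc : S (suc m) ≡ S m + n C (k + m)
  S-suc = begin
    sum (map (λ j → n C (k + j)) (upTo (suc m)))
      ≡⟨ cong (λ l → sum (map (λ j → n C (k + j)) l)) (sym (upTo-∷ʳ m)) ⟩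
    sum (map (λ j → n C (k + j)) (upTo m ++ [ m ]))
      ≡⟨ cong sum (map-++ (λ j → n C (k + j)) (upTo m) [ m ]) ⟩
    sum (map (λ j → n C (k + j)) (upTo m) ++ [ n C (k + m) ])
      ≡⟨ sum-++ (map (λ j → n C (k + j)) (upTo m)) _ ⟩
    S m + (n C (k + m) + 0)
      ≡⟨ cong (S m +_) (+-identityʳ _) ⟩
    S m + n C (k + m) ∎

length-large : ∀ k → length (large (2 + k)) ≡ sumBinomFrom3 (2 + k)
length-large k = trans (#atLeast (2 + k) 3 k) (trans (cong (sumBinomFrom3 (2 + k) +_) none) (+-identityʳ _))
  where
  none : length (filter (λ X → (3 + k) ≤? ∣ X ∣) (allSubsets (2 + k))) ≡ 0
  none = cong length (filter-none (λ X → (3 + k) ≤? ∣ X ∣) (All.universal (λ X → ℕP.<⇒≱ (s≤s (SubP.∣p∣≤n X))) (allSubsets (2 + k))))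

indicator-cong : ∀ {a b} {A : Set a} {B : Set b} (p : Dec A) (q : Dec B) → (A → B) → (B → A) → indicator p ≡ indicator q
indicator-cong (yes _) (yes _) f g = refl
indicator-cong (no _)  (no _)  f g = refl
indicator-cong (yes a) (no ¬b) f g = contradiction (f a) ¬b
indicator-cong (no ¬a) (yes b) f g = contradiction (g b) ¬a

admissible-↭ : {𝓕 𝓖 : Family n} → 𝓕 ↭ 𝓖 → length 𝓕 ≡ s × Intersecting 𝓕 → length 𝓖 ≡ s × Intersecting 𝓖
admissible-↭ 𝓕↭𝓖 (len , int) = trans (sym (↭-length 𝓕↭𝓖)) len ,
  All.tabulate λ X∈ → All.tabulate λ Y∈ → All.lookup (All.lookup int (∈-resp-↭ (↭-sym 𝓕↭𝓖) X∈)) (∈-resp-↭ (↭-sym 𝓕↭𝓖) Y∈)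

-- A sublist of `𝓑 ++ large n` splits at the boundary into its trace and its large part. The list
-- `𝓐` may have another order, but admissibility does not depend on order.
numIntersecting-sum : {𝓐 𝓑 : Family n} → 𝓐 ↭ 𝓑 ++ large n → numIntersecting s 𝓐 ≡ sumSub (#extensions s) 𝓑
numIntersecting-sum {n} {s} {𝓐} {𝓑} 𝓐↭ = begin
  numIntersecting s 𝓐
    ≡⟨ length-filter-sublists (admissible? s) 𝓐 ⟩
  sumSub (indicator ∘ admissible? s) 𝓐
    ≡⟨ sumSub-↭ (indicator ∘ admissible? s)
         (λ {𝓕} {𝓖} 𝓕↭𝓖 → indicator-cong (admissible? s 𝓕) (admissible? s 𝓖) (admissible-↭ 𝓕↭𝓖) (admissible-↭ (↭-sym 𝓕↭𝓖))) 𝓐↭ ⟩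
  sumSub (indicator ∘ admissible? s) (𝓑 ++ large n)
    ≡⟨ sumSub-++ (indicator ∘ admissible? s) 𝓑 (large n) ⟩
  sumSub (λ T → sumSub (λ G → indicator (admissible? s (T ++ G))) (large n)) 𝓑
    ≡⟨ sumSub-cong 𝓑 (λ T → sym (trans (#extensions≡length s T)
         (length-filter-sublists (λ G → admissible? s (T ++ G)) (large n)))) ⟩
  sumSub (#extensions s) 𝓑 ∎
  where open ≡-Reasoning

sum-map-const : ∀ {a} {A : Set a} (f : A → ℕ) {c} xs → (∀ {x} → x ∈ xs → f x ≡ c) → sum (map f xs) ≡ length xs * c
sum-map-const f []       f≡c = refl
sum-map-const f (x ∷ xs) f≡c = cong₂ _+_ (f≡c (here refl)) (sum-map-const f xs (λ x∈ → f≡c (there x∈)))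

sum-map-filter : ∀ {a p} {A : Set a} {P : A → Set p} (P? : ∀ x → Dec (P x)) (f : A → ℕ) {c} xs →
  (∀ {x} → x ∈ xs → P x → f x ≡ c) → (∀ {x} → x ∈ xs → ¬ P x → f x ≡ 0) → sum (map f xs) ≡ length (filter P? xs) * c
sum-map-filter P? f []       f≡c f≡0 = refl
sum-map-filter P? f (x ∷ xs) f≡c f≡0
  with ih ← sum-map-filter P? f xs (λ x∈ → f≡c (there x∈)) (λ x∈ → f≡0 (there x∈)) | P? x
... | yes p = cong₂ _+_ (f≡c (here refl) p) ih
... | no ¬p = cong₂ _+_ (f≡0 (here refl) ¬p) ih

#extensions-singles : {𝓑 : Family (2 + k)} → Pairs 𝓑 →
  sum (map (λ X → #extensions s [ X ]) 𝓑) ≡ length 𝓑 * #extensions s [ edge {k} ]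
#extensions-singles {s = s} {𝓑} (_ , two) =
  sum-map-const (λ X → #extensions s [ X ]) 𝓑 (λ X∈ → #extensions-single (All.lookup two X∈))

#extensions-pairs : {𝓑 : Family (3 + k)} → Pairs 𝓑 →
  sumPairs (λ X Y → #extensions s (X ∷ Y ∷ [])) 𝓑 ≡ intersectingPairs 𝓑 * γ s k
#extensions-pairs {𝓑 = []} _ = refl
#extensions-pairs {k} {s} {X ∷ 𝓑} pairs@((X∉ ∷ _) , (∣X∣≡2 ∷ two)) = trans
  (cong₂ _+_
    (sum-map-filter (λ Y → nonempty? (X ∩ Y)) (λ Y → #extensions s (X ∷ Y ∷ [])) 𝓑 (λ Y∈ → #extensions-pair (pair Y∈)) disjoint)
    (#extensions-pairs (pairs-tail pairs)))
  (sym (ℕP.*-distribʳ-+ (γ s k) (length (filter (λ Y → nonempty? (X ∩ Y)) 𝓑)) _))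
  where
  pair : ∀ {Y} → Y ∈ 𝓑 → Pairs (X ∷ Y ∷ [])
  pair Y∈ = ((All.lookup X∉ Y∈ ∷ []) ∷ [] ∷ []) , ∣X∣≡2 ∷ All.lookup two Y∈ ∷ []
  disjoint : ∀ {Y} → Y ∈ 𝓑 → ¬ Nonempty (X ∩ Y) → #extensions s (X ∷ Y ∷ []) ≡ 0
  disjoint Y∈ ¬ne with #extensions-meeting {s = s} (pair Y∈)
  ... | inj₁ ≡0    = ≡0
  ... | inj₂ meets = contradiction (meets (here refl) (there (here refl))) ¬ne

OfForm : Family n → Family n → Set
OfForm 𝓐 𝓑 = ∀ X → (X ∈ 𝓐) ⇔ ((3 ≤ ∣ X ∣) ⊎ (X ∈ 𝓑))

ofForm⇒↭ : {𝓐 𝓑 : Family n} → Unique 𝓐 → Pairs 𝓑 → OfForm 𝓐 𝓑 → 𝓐 ↭ 𝓑 ++ large n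
ofForm⇒↭ {n} {𝓐} {𝓑} u𝓐 pairs form = unique⇒↭ u𝓐 (++-unique pairs (large-unique n) (λ X∈ → X∈))
  (λ X∈ → into (Equivalence.to (form _) X∈)) (λ X∈ → Equivalence.from (form _) (onto (∈-++⁻ 𝓑 X∈)))
  where
  into : ∀ {X} → 3 ≤ ∣ X ∣ ⊎ X ∈ 𝓑 → X ∈ 𝓑 ++ large n
  into (inj₁ 3≤) = ∈-++⁺ʳ 𝓑 (∈-large⁺ 3≤)
  into (inj₂ X∈) = ∈-++⁺ˡ X∈
  onto : ∀ {X} → X ∈ 𝓑 ⊎ X ∈ large n → 3 ≤ ∣ X ∣ ⊎ X ∈ 𝓑
  onto (inj₁ X∈) = inj₂ X∈
  onto (inj₂ X∈) = inj₁ (∈-large⁻ X∈)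

ofForm-++ : (𝓑 : Family n) → OfForm (𝓑 ++ large n) 𝓑
ofForm-++ 𝓑 X = mk⇔
  (λ X∈ → Sum.[ inj₂ , inj₁ ∘ ∈-large⁻ ] (∈-++⁻ 𝓑 X∈))
  (Sum.[ (λ 3≤ → ∈-++⁺ʳ 𝓑 (∈-large⁺ 3≤)) , ∈-++⁺ˡ ])

-- One more intersecting pair brings `𝓒` at least one further γ₀, which already exceeds everything
-- that the larger traces of `𝓑` contribute. The larger traces of `𝓒` can simply be dropped.
fewer-pairs : ∀ {j} → 48 ≤ 2 ^ j → poly (6 + j) < 12 * 2 ^ j → 2 ≤ s → s ≤ 2 ^ (5 + j) →
  {𝓑 𝓒 : Family (6 + j)} → Pairs 𝓑 → Pairs 𝓒 → length 𝓑 ≡ length 𝓒 →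
  intersectingPairs 𝓑 < intersectingPairs 𝓒 → sumSub (#extensions s) 𝓑 < sumSub (#extensions s) 𝓒
fewer-pairs {s} {j} 48≤ small 2≤s s≤ {𝓑} {𝓒} pairs𝓑 pairs𝓒 len less = begin-strict
  sumSub h 𝓑
    ≡⟨ layers pairs𝓑 ⟩
  h [] + length 𝓑 * h₁ + intersectingPairs 𝓑 * γ₀ + sumSub (from₃ h) 𝓑
    <⟨ ℕP.+-monoʳ-< (h [] + length 𝓑 * h₁ + intersectingPairs 𝓑 * γ₀)
         (large-traces-< pairs𝓑 (#extensions-pair-positive (s≤s (s≤s z≤n)) 2≤s s≤)) ⟩
  h [] + length 𝓑 * h₁ + intersectingPairs 𝓑 * γ₀ + γ₀
    ≡⟨ rearrange (h [] + length 𝓑 * h₁) (intersectingPairs 𝓑 * γ₀) γ₀ ⟩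
  h [] + length 𝓑 * h₁ + suc (intersectingPairs 𝓑) * γ₀
    ≤⟨ ℕP.+-mono-≤ (≤-reflexive (cong (λ l → h [] + l * h₁) len)) (ℕP.*-monoˡ-≤ γ₀ less) ⟩
  h [] + length 𝓒 * h₁ + intersectingPairs 𝓒 * γ₀
    ≤⟨ m≤m+n _ _ ⟩
  h [] + length 𝓒 * h₁ + intersectingPairs 𝓒 * γ₀ + sumSub (from₃ h) 𝓒
    ≡⟨ layers pairs𝓒 ⟨
  sumSub h 𝓒 ∎
  where
  open ℕP.≤-Reasoning
  open LargeTraces s j 48≤ small
  h = #extensions {6 + j} s
  h₁ = #extensions s [ edge {4 + j} ]
  γ₀ = γ s (3 + j)
  rearrange : ∀ a b c → a + b + c ≡ a + (c + b)
  rearrange = solve-∀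
  layers : ∀ {𝓓} → Pairs 𝓓 → sumSub h 𝓓 ≡ h [] + length 𝓓 * h₁ + intersectingPairs 𝓓 * γ₀ + sumSub (from₃ h) 𝓓
  layers {𝓓} pairs = trans (sumSub-layers h 𝓓) (cong (_+ sumSub (from₃ h) 𝓓)
    (cong₂ (λ a b → h [] + a + b) (#extensions-singles pairs) (#extensions-pairs pairs)))

theorem3 : (n s i : ℕ) → 21 ≤ n → 2 ≤ s → s ≤ 2 ^ (n ∸ 1) → i ≤ n C 2 →
    (𝓐 𝓑 : Family n) → Unique 𝓐 → Unique 𝓑 → All (λ B → ∣ B ∣ ≡ 2) 𝓑 →
    (∀ X → (X ∈ 𝓐) ⇔ ((3 ≤ ∣ X ∣) ⊎ (X ∈ 𝓑))) →
    length 𝓐 ≡ sumBinomFrom3 n + i →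
    (∀ (𝓐' 𝓑' : Family n) → Unique 𝓐' → Unique 𝓑' → All (λ B → ∣ B ∣ ≡ 2) 𝓑' →
    (∀ X → (X ∈ 𝓐') ⇔ ((3 ≤ ∣ X ∣) ⊎ (X ∈ 𝓑'))) →
    length 𝓐' ≡ sumBinomFrom3 n + i →
    numIntersecting s 𝓐' ≤ numIntersecting s 𝓐) →
    (length 𝓑 ≡ i) × All (λ B → ∣ B ∣ ≡ 2) 𝓑 ×
    (∀ (𝓑' : Family n) → Unique 𝓑' → All (λ B → ∣ B ∣ ≡ 2) 𝓑' → length 𝓑' ≡ i →
    intersectingPairs 𝓑' ≤ intersectingPairs 𝓑)
theorem3 n s i 21≤n 2≤s s≤ _ 𝓐 𝓑 u𝓐 u𝓑 two form size𝓐 maximal with ℕP.m≤n⇒∃[o]m+o≡n (≤-trans (m≤m+n 6 15) 21≤n)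
... | j , refl = length-𝓑 , two , λ 𝓒 u𝓒 two𝓒 length-𝓒 → ℕP.≮⇒≥ λ less →
  ℕP.<⇒≱ (fewer-pairs (≤-trans (ℕP.≤ᵇ⇒≤ 48 (2 ^ 15) tt) (ℕP.^-monoʳ-≤ 2 15≤j)) (poly-bound 15≤j) 2≤s s≤
           (u𝓑 , two) (u𝓒 , two𝓒) (trans length-𝓑 (sym length-𝓒)) less)
    (subst₂ _≤_ (numIntersecting-sum {s = s} {𝓑 = 𝓒} ↭-refl) (numIntersecting-sum {s = s} 𝓐↭)
      -- A family `𝓒` with more intersecting pairs is completed by all large sets to a competitor of
      -- `𝓐`.
      (maximal (𝓒 ++ large (6 + j)) 𝓒 (++-unique (u𝓒 , two𝓒) (large-unique (6 + j)) (λ X∈ → X∈)) u𝓒 two𝓒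
        (ofForm-++ 𝓒) (length-++-large 𝓒 length-𝓒)))
  where
  15≤j : 15 ≤ j
  15≤j = ℕP.+-cancelˡ-≤ 6 15 j 21≤n
  𝓐↭ : 𝓐 ↭ 𝓑 ++ large (6 + j)
  𝓐↭ = ofForm⇒↭ u𝓐 (u𝓑 , two) form
  length-++-large : ∀ 𝓒 {l} → length 𝓒 ≡ l → length (𝓒 ++ large (6 + j)) ≡ sumBinomFrom3 (6 + j) + l
  length-++-large 𝓒 refl =
    trans (length-++ 𝓒) (trans (ℕP.+-comm (length 𝓒) _) (cong (_+ length 𝓒) (length-large (4 + j))))
  length-𝓑 : length 𝓑 ≡ i
  length-𝓑 = ℕP.+-cancelˡ-≡ (sumBinomFrom3 (6 + j)) _ _
    (trans (sym (length-++-large 𝓑 refl)) (trans (sym (↭-length 𝓐↭)) size𝓐))
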